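{- Let $n\ge 1$. Sending a noncrossing partition $\pi$ of $[n]$ to the bicolored plane tree $\mathcal T(\pi)$ obtained from its polygon diagram (one yellow vertex for each yellow region, one white vertex for each white region, one edge for each polygon side, as defined in the context) induces a well-defined bijection from the set of rotation classes of noncrossing partitions of $[n]$ to the set of bicolored plane trees with $n$ edges.
   Context: Write $[n]=\{1,2,\dots,n\}$. A partition of $[n]$ is noncrossing if no quadruple $a<b<c<d$ has $a,c$ in one block and $b,d$ in a different block. The rotation operator $R$ on partitions of $[n]$ is induced by the map $i\mapsto i+1 \pmod n$ on $[n]$; it preserves the noncrossing property. The rotation class of $\pi$ is $\{R^{i}(\pi): i\ge 1\}$. A bicolored plane tree is a plane tree (no root, no labels; that is, a finite tree together with a cyclic order of the edges around each vertex, considered up to isomorphisms preserving these cyclic orders) in which each vertex is colored white or yellow so that adjacent vertices get different colors; isomorphisms of bicolored plane trees also preserve colors. Polygon diagram: place points labelled $1,2,\dots,n$ in clockwise order on a circle bounding a disk. Each block of size $k$ of a noncrossing partition $\pi$ is represented by a yellow $k$-sided polygon in the disk whose vertices are the points of the block: for $k\ge 3$ the convex hull; for $k=2$ a thin digon with two sides joining the two points; for $k=1$ a small one-sided polygon (a loop with its interior) attached to the circle at the single point. The polygons are pairwise disjoint and have $n$ sides in total. The yellow regions are the polygons; the white regions are the connected components of the rest of the disk. The tree $\mathcal T(\pi)$ has one vertex in each region, colored with the color of the region, and, for each polygon side, an edge crossing that side and joining the vertices of the two regions (one yellow, one white) adjacent along that side; the cyclic order of edges around vertices is the one coming from the planar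 drawing. Only the bicolored plane tree, not the labels $1,\dots,n$, is retained. -}

module Defs where

open import Data.Bool.Base using (if_then_else_)
open import Data.Fin.Base using (Fin; toℕ; _<_; _≤_)
open import Data.Fin.Properties using (_<?_; _≤?_; all?)
open import Data.List.Base using (List; []; _∷_)
open import Data.List.Relation.Unary.AllPairs using (AllPairs)
open import Data.List.Relation.Unary.Unique.Propositional using (Unique)
open import Data.Nat.Base using (ℕ; zero; suc; _+_; _∸_; NonZero)
open import Data.Nat.DivMod using (_mod_)
open import Data.Nat.GeneralisedArithmetic using (fold)
open import Data.Product.Base using (_×_; _,_; proj₁; proj₂; ∃-syntax)
open import Data.Sum.Base using (_⊎_)
open import Function.Base using (_on_)
open import Function.Bundles using (_⇔_; _↔_; Inverse)
open import Function.Definitions using (StrictlySurjective)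
open import Level using (0ℓ)
open import Relation.Binary.Bundles using (Setoid)
open import Relation.Binary.Core using (Rel)
open import Relation.Binary.Definitions using (Decidable)
import Relation.Binary.Construct.On as On
open import Relation.Binary.PropositionalEquality.Core using (_≡_; _≢_)
open import Relation.Binary.Structures using (IsDecEquivalence)
open import Relation.Nullary.Decidable using (does; _×-dec_; _⊎-dec_; _→-dec_)
open import Relation.Nullary.Negation using (¬_)
import Relation.Unary as U

------------------------------------------------------------------------
-- Noncrossing partitions and rotation

-- The points 1, …, n in clockwise order are the elements 0, …, n-1 of
-- Fin n.  A partition is given by the relation "lies in the same block as".
record Partition (n : ℕ) : Set₁ where
  field
    _∼_              : Rel (Fin n) 0ℓ
    isDecEquivalence : IsDecEquivalence _∼_

  open IsDecEquivalence isDecEquivalence public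
    using () renaming (_≟_ to _∼?_)

_≐_ : ∀ {n} → Partition n → Partition n → Set
π ≐ ρ = ∀ i j → (Partition._∼_ π i j) ⇔ (Partition._∼_ ρ i j)

Noncrossing : ∀ {n} → Partition n → Set
Noncrossing π = ∀ {a b c d} → a < b → b < c → c < d →
                ¬ (a ∼ c × b ∼ d × ¬ (a ∼ b))
  where open Partition π

record NoncrossingPartition (n : ℕ) : Set₁ where
  field
    partition   : Partition n
    noncrossing : Noncrossing partition

  open Partition partition public

module _ {n : ℕ} .{{_ : NonZero n}} where

  rotate : Fin n → Fin n
  rotate i = (toℕ i + 1) mod n

  rotate⁻¹ : Fin n → Fin n
  rotate⁻¹ i = (toℕ i + (n ∸ 1)) mod n

  -- The blocks of R π are the images under rotate of the blocks of π, so
  -- i and j share a block of R π iff rotate⁻¹ i and rotate⁻¹ j share one of π.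
  R : Partition n → Partition n
  R π = record
    { _∼_              = _∼_ on rotate⁻¹
    ; isDecEquivalence = On.isDecEquivalence rotate⁻¹ isDecEquivalence
    } where open Partition π

  -- π ~ᴿ ρ: ρ lies in the rotation class { Rᵏ(π) : k ≥ 1 } of π.
  _~ᴿ_ : Rel (NoncrossingPartition n) 0ℓ
  π ~ᴿ ρ = ∃[ k ] (k ≢ 0 × fold (partition π) R k ≐ partition ρ)
    where open NoncrossingPartition

------------------------------------------------------------------------
-- Bicolored plane trees

data Colour : Set where
  white yellow : Colour

opposite : Colour → Colour
opposite white  = yellow
opposite yellow = white

-- Raw data with edge set Fin n.  As adjacent vertices are to have different
-- colours, an edge e has one end of each colour; end c e is the one of
-- colour c, and next c e is the edge following e clockwise around end c e.
record BicoloredPlaneGraph (n : ℕ) : Set₁ where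
  infix 4 _≈_
  field
    V      : Set
    _≈_    : Rel V 0ℓ
    colour : V → Colour
    end    : Colour → Fin n → V
    next   : Colour → Fin n → Fin n

module _ {n : ℕ} (G : BicoloredPlaneGraph n) where
  open BicoloredPlaneGraph G

  data Walk : V → V → Set where
    stop : ∀ {v w} → v ≈ w → Walk v w
    step : ∀ {v w} (c : Colour) (e : Fin n) → v ≈ end c e →
           Walk (end (opposite c) e) w → Walk v w

  edges : ∀ {v w} → Walk v w → List (Fin n)
  edges (stop _)       = []
  edges (step _ e _ p) = e ∷ edges p

  -- The last vertex is left out, so that for a closed walk the common
  -- first and last vertex is listed once.
  vertices : ∀ {v w} → Walk v w → List V
  vertices (stop _)           = []
  vertices (step {v} _ _ _ p) = v ∷ vertices p

  IsCycle : ∀ {v} → Walk v v → Set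
  IsCycle p = edges p ≢ [] × Unique (edges p) ×
              AllPairs (λ x y → ¬ (x ≈ y)) (vertices p)

  -- next-end and next-cyclic say that next c restricts to a single cyclic
  -- permutation of the edges at each vertex of colour c: being transitive on
  -- that finite set, it is surjective on it, hence a bijection.
  record IsBicoloredPlaneTree : Set where
    field
      isDecEquivalence : IsDecEquivalence _≈_
      finite           : ∃[ m ] ∃[ enum ] StrictlySurjective {A = Fin m} _≈_ enum
      colour-cong      : ∀ {v w} → v ≈ w → colour v ≡ colour w
      end-colour       : ∀ c e → colour (end c e) ≡ c
      next-end         : ∀ c e → end c (next c e) ≈ end c e
      next-cyclic      : ∀ c {e f} → end c e ≈ end c f →
                         ∃[ k ] fold e (next c) k ≡ f
      connected        : ∀ v w → Walk v w
      acyclic          : ∀ {v} (p : Walk v v) → ¬ IsCycle p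

record BicoloredPlaneTree (n : ℕ) : Set₁ where
  constructor planeTree
  field
    graph  : BicoloredPlaneGraph n
    isTree : IsBicoloredPlaneTree graph

  open BicoloredPlaneGraph graph public
  open IsBicoloredPlaneTree isTree public

  vertexSetoid : Setoid 0ℓ 0ℓ
  vertexSetoid = record
    { isEquivalence = IsDecEquivalence.isEquivalence isDecEquivalence }

record _≅_ {n : ℕ} (S T : BicoloredPlaneTree n) : Set where
  private
    module S = BicoloredPlaneTree S
    module T = BicoloredPlaneTree T
  field
    onVertices : Inverse S.vertexSetoid T.vertexSetoid
    onEdges    : Fin n ↔ Fin n

  private
    module F = Inverse onVertices
    module E = Inverse onEdges

  field
    colour-preserving : ∀ v → T.colour (F.to v) ≡ S.colour v
    end-preserving    : ∀ c e → F.to (S.end c e) T.≈ T.end c (E.to e)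
    next-preserving   : ∀ c e → E.to (S.next c e) ≡ T.next c (E.to e)

------------------------------------------------------------------------
-- The tree of a noncrossing partition

-- Arc i is the open circle arc from point i clockwise to the next point.
-- Cut the disk by a curve from arc i to arc j: OneSide i j consists of the
-- points on the side of the cut not containing point 0.
OneSide : ∀ {n} → Fin n → Fin n → U.Pred (Fin n) 0ℓ
OneSide i j p = (i < p × p ≤ j) ⊎ (j < p × p ≤ i)

oneSide? : ∀ {n} (i j : Fin n) → U.Decidable (OneSide i j)
oneSide? i j p = ((i <? p) ×-dec (p ≤? j)) ⊎-dec ((j <? p) ×-dec (p ≤? i))

module _ {n : ℕ} .{{_ : NonZero n}} where

  search : {P : U.Pred (Fin n) 0ℓ} → U.Decidable P → ℕ → Fin n → Fin n
  search P? zero    i = i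
  search P? (suc k) i = if does (P? i) then i else search P? k (rotate i)

  -- The first of i+1, i+2, …, i+n = i (mod n) that is related to i.
  nextRelated : {_∼_ : Rel (Fin n) 0ℓ} → Decidable _∼_ → Fin n → Fin n
  nextRelated _∼?_ i = search (i ∼?_) n (rotate i)

  module _ (π : NoncrossingPartition n) where
    open NoncrossingPartition π

    -- Every white region is bounded by at least one arc.  Two arcs bound the
    -- same connected component of the complement of the polygons iff no
    -- polygon separates them, i.e. no block has points on both sides of a
    -- cut from one arc to the other.
    SameWhiteRegion : Rel (Fin n) 0ℓ
    SameWhiteRegion i j = ∀ p q → p ∼ q → OneSide i j p → OneSide i j q

    sameWhiteRegion? : Decidable SameWhiteRegion
    sameWhiteRegion? i j = all? λ p → all? λ q →
      (p ∼? q) →-dec (oneSide? i j p →-dec oneSide? i j q)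

    -- Yellow regions are named by the points of their block, white regions
    -- by the arcs on their boundary.
    SameRegion : Colour → Rel (Fin n) 0ℓ
    SameRegion yellow = _∼_
    SameRegion white  = SameWhiteRegion

    sameRegion? : ∀ c → Decidable (SameRegion c)
    sameRegion? yellow = _∼?_
    sameRegion? white  = sameWhiteRegion?

    -- Side i is the polygon side that leaves point i when its polygon is
    -- traversed clockwise; it ends at the next point of the block (at i itself
    -- for a singleton).  Inside it is the block of i, and outside it is the
    -- white region containing arc i.
    --
    -- Clockwise around a yellow vertex, side i is followed by the side leaving
    -- the next point of the block.  The clockwise boundary of a white region
    -- alternates between sides and arcs, side i (traversed towards point i)
    -- immediately preceding arc i; so side i is followed by side j, where arc j
    -- is the next arc of the region clockwise.
    𝒯 : BicoloredPlaneGraph n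
    𝒯 = record
      { V      = Colour × Fin n
      ; _≈_    = λ v w → proj₁ v ≡ proj₁ w × SameRegion (proj₁ v) (proj₂ v) (proj₂ w)
      ; colour = proj₁
      ; end    = _,_
      ; next   = λ c → nextRelated (sameRegion? c)
      }

{-# OPTIONS --safe #-}

-- A bicolored plane tree amounts to two permutations of its edges, turning to
-- the next edge around the white and around the yellow ends.  For the tree of a
-- noncrossing partition their composite (first white, then yellow) is the
-- rotation i ↦ i + 1.  Hence an isomorphism between two such trees commutes
-- with the rotation on edges and so is a rotation itself, and it carries blocks,
-- being yellow vertices, to blocks.  For an arbitrary tree the composite is the
-- walk around the tree.  Deleting an edge disconnects its ends, and the walk
-- passes between the two parts only along that edge; this makes the composite a
-- single n-cycle, and makes the edges beyond the white end of an edge an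
-- interval of that cycle.  Numbering the edges along the cycle, the yellow
-- vertices become the blocks of a noncrossing partition with the given tree.
module Submission where

open import Defs
open import Data.Bool.Base using (Bool; true; false; _xor_)
open import Data.Bool.Properties using (xor-same; ⇔→≡)
open import Data.Bool.Solver using (module xor-∧-Solver)
open import Data.Empty using (⊥; ⊥-elim)
open import Data.Fin.Base using (Fin; zero; suc; toℕ; fromℕ; _↑ˡ_; _↑ʳ_; splitAt)
import Data.Fin.Properties as Fin
open import Data.List.Base using (List; []; _∷_)
open import Data.List.Membership.Propositional using (_∈_; _∉_)
open import Data.List.Relation.Unary.All as All using (All; []; _∷_)
import Data.List.Relation.Unary.All.Properties as All
open import Data.List.Relation.Unary.AllPairs using (AllPairs; []; _∷_)
open import Data.List.Relation.Unary.Any using (Any; here; there; any?)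
open import Data.List.Relation.Unary.Unique.Propositional using (Unique)
open import Data.Nat.Base
open import Data.Nat.DivMod
open import Data.Nat.GeneralisedArithmetic using (fold; fold-+)
open import Data.Nat.Induction using (<-wellFounded; Acc; acc)
open import Data.Nat.Properties
open import Data.Product.Base using (_×_; _,_; proj₁; proj₂; ∃-syntax; Σ-syntax)
open import Data.Sum.Base using (_⊎_; inj₁; inj₂; [_,_]′)
open import Function.Bundles using (_⇔_; mk⇔; Equivalence; _↔_; mk↔ₛ′; Inverse)
open import Function.Construct.Composition using (_⇔-∘_; _↔-∘_)
open import Function.Construct.Identity using (⇔-id; ↔-id)
open import Function.Construct.Symmetry using (⇔-sym; ↔-sym)
open import Function.Structures using (IsBijection)
open import Level using (0ℓ)
open import Relation.Binary.Core using (Rel)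
open import Relation.Binary.Definitions using (Decidable; DecidableEquality; Transitive; tri<; tri≈; tri>)
import Relation.Binary.Construct.On as On
open import Relation.Binary.PropositionalEquality using (_≡_; _≢_; refl; sym; trans; cong; cong₂; subst; subst₂; module ≡-Reasoning)
open import Relation.Binary.Structures using (IsEquivalence; IsDecEquivalence)
open import Relation.Nullary.Decidable using (yes; no; map′; dec-true; dec-false)
open import Relation.Nullary.Negation using (¬_)
import Relation.Unary as U

-- Iterates of a map, and sums modulo n

fold-suc : ∀ {A : Set} (s : A → A) k {z} → fold (s z) s k ≡ s (fold z s k)
fold-suc s zero    = refl
fold-suc s (suc k) = cong s (fold-suc s k)

fold-map : ∀ {A B : Set} {s : A → A} {t : B → B} (f : A → B) →
           (∀ z → f (s z) ≡ t (f z)) → ∀ k {z} → f (fold z s k) ≡ fold (f z) t k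
fold-map f f-s zero    = refl
fold-map {t = t} f f-s (suc k) = trans (f-s _) (cong t (fold-map f f-s k))

fold-period : ∀ {A : Set} (s : A → A) {z} p → fold z s p ≡ z → ∀ k → fold z s (k * p) ≡ z
fold-period s p z-p zero    = refl
fold-period s {z} p z-p (suc k) =
  trans (fold-+ z s p) (trans (cong (λ x → fold x s p) (fold-period s p z-p k)) z-p)

[m%n+o]%n≡[m+o]%n : ∀ m o n .{{_ : NonZero n}} → (m % n + o) % n ≡ (m + o) % n
[m%n+o]%n≡[m+o]%n m o n = begin
  (m % n + o) % n         ≡⟨ %-distribˡ-+ (m % n) o n ⟩
  (m % n % n + o % n) % n ≡⟨ cong (λ x → (x + o % n) % n) (m%n%n≡m%n m n) ⟩
  (m % n + o % n) % n     ≡⟨ %-distribˡ-+ m o n ⟨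
  (m + o) % n             ∎
  where open ≡-Reasoning

-- Rotation of the points

module _ {n : ℕ} .{{_ : NonZero n}} where

  rot : ℕ → Fin n → Fin n
  rot k i = fold i rotate k

  rot-rotate : ∀ k i → rot k (rotate i) ≡ rotate (rot k i)
  rot-rotate k i = fold-suc rotate k

  rot-+ : ∀ k l i → rot (k + l) i ≡ rot k (rot l i)
  rot-+ k l i = fold-+ i rotate k

  rot-comm : ∀ k l i → rot k (rot l i) ≡ rot l (rot k i)
  rot-comm k l i = begin
    rot k (rot l i) ≡⟨ rot-+ k l i ⟨
    rot (k + l) i   ≡⟨ cong (λ x → rot x i) (+-comm k l) ⟩
    rot (l + k) i   ≡⟨ rot-+ l k i ⟩
    rot l (rot k i) ∎
    where open ≡-Reasoning

  toℕ-mod : ∀ k → toℕ (k mod n) ≡ k % n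
  toℕ-mod k = Fin.toℕ-fromℕ< (m%n<n k n)

  toℕ-rot : ∀ k i → toℕ (rot k i) ≡ (toℕ i + k) % n
  toℕ-rot zero i = begin
    toℕ i           ≡⟨ m<n⇒m%n≡m (Fin.toℕ<n i) ⟨
    toℕ i % n       ≡⟨ cong (_% n) (+-identityʳ (toℕ i)) ⟨
    (toℕ i + 0) % n ∎
    where open ≡-Reasoning
  toℕ-rot (suc k) i = begin
    toℕ (rotate (rot k i))     ≡⟨ toℕ-mod _ ⟩
    (toℕ (rot k i) + 1) % n    ≡⟨ cong (λ x → (x + 1) % n) (toℕ-rot k i) ⟩
    ((toℕ i + k) % n + 1) % n  ≡⟨ [m%n+o]%n≡[m+o]%n (toℕ i + k) 1 n ⟩
    (toℕ i + k + 1) % n        ≡⟨ cong (_% n) (+-assoc (toℕ i) k 1) ⟩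
    (toℕ i + (k + 1)) % n      ≡⟨ cong (λ x → (toℕ i + x) % n) (+-comm k 1) ⟩
    (toℕ i + suc k) % n        ∎
    where open ≡-Reasoning

  toℕ-rot-< : ∀ k i → toℕ i + k < n → toℕ (rot k i) ≡ toℕ i + k
  toℕ-rot-< k i lt = trans (toℕ-rot k i) (m<n⇒m%n≡m lt)

  rot-n : ∀ i → rot n i ≡ i
  rot-n i = Fin.toℕ-injective (begin
    toℕ (rot n i)   ≡⟨ toℕ-rot n i ⟩
    (toℕ i + n) % n ≡⟨ [m+n]%n≡m%n (toℕ i) n ⟩
    toℕ i % n       ≡⟨ m<n⇒m%n≡m (Fin.toℕ<n i) ⟩
    toℕ i           ∎)
    where open ≡-Reasoning

  rot-*n : ∀ k i → rot (k * n) i ≡ i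
  rot-*n k i = fold-period rotate n (rot-n i) k

  rot-transitive : ∀ i j → ∃[ k ] (k < n × rot k i ≡ j)
  rot-transitive i j = k , m%n<n _ n , Fin.toℕ-injective (begin
    toℕ (rot k i)                       ≡⟨ toℕ-rot k i ⟩
    (toℕ i + k) % n                     ≡⟨ cong (_% n) (+-comm (toℕ i) k) ⟩
    (k + toℕ i) % n                     ≡⟨ [m%n+o]%n≡[m+o]%n (toℕ j + (n ∸ toℕ i)) (toℕ i) n ⟩
    (toℕ j + (n ∸ toℕ i) + toℕ i) % n   ≡⟨ cong (_% n) (+-assoc (toℕ j) _ (toℕ i)) ⟩
    (toℕ j + (n ∸ toℕ i + toℕ i)) % n   ≡⟨ cong (λ x → (toℕ j + x) % n) (m∸n+n≡m (Fin.toℕ≤n i)) ⟩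
    (toℕ j + n) % n                     ≡⟨ [m+n]%n≡m%n (toℕ j) n ⟩
    toℕ j % n                           ≡⟨ m<n⇒m%n≡m (Fin.toℕ<n j) ⟩
    toℕ j                               ∎)
    where
    open ≡-Reasoning
    k = (toℕ j + (n ∸ toℕ i)) % n

  rotate⁻¹-rot : ∀ i → rotate⁻¹ i ≡ rot (n ∸ 1) i
  rotate⁻¹-rot i = Fin.toℕ-injective (trans (toℕ-mod _) (sym (toℕ-rot (n ∸ 1) i)))

  rotate-rotate⁻¹ : ∀ i → rotate (rotate⁻¹ i) ≡ i
  rotate-rotate⁻¹ i = begin
    rotate (rotate⁻¹ i)      ≡⟨ cong rotate (rotate⁻¹-rot i) ⟩
    rot (suc (n ∸ 1)) i      ≡⟨ cong (λ x → rot x i) (m+[n∸m]≡n (>-nonZero⁻¹ n)) ⟩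
    rot n i                  ≡⟨ rot-n i ⟩
    i                        ∎
    where open ≡-Reasoning

  rotate⁻¹-rotate : ∀ i → rotate⁻¹ (rotate i) ≡ i
  rotate⁻¹-rotate i = begin
    rotate⁻¹ (rotate i)     ≡⟨ rotate⁻¹-rot (rotate i) ⟩
    rot (n ∸ 1) (rotate i)  ≡⟨ rot-rotate (n ∸ 1) i ⟩
    rotate (rot (n ∸ 1) i)  ≡⟨ cong rotate (rotate⁻¹-rot i) ⟨
    rotate (rotate⁻¹ i)     ≡⟨ rotate-rotate⁻¹ i ⟩
    i                       ∎
    where open ≡-Reasoning

  rotate-injective : ∀ {i j} → rotate i ≡ rotate j → i ≡ j
  rotate-injective {i} {j} eq =
    trans (sym (rotate⁻¹-rotate i)) (trans (cong rotate⁻¹ eq) (rotate⁻¹-rotate j))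

  rot-injective : ∀ k {i j} → rot k i ≡ rot k j → i ≡ j
  rot-injective zero    eq = eq
  rot-injective (suc k) eq = rot-injective k (rotate-injective eq)

  -- Rotations commute and act transitively, so a fixed point of `rot k` would make point 0 fixed
  -- too, and then `k % n` is 0.
  rot-≢ : ∀ {k} i → 0 < k → k < n → rot k i ≢ i
  rot-≢ {k} i 0<k k<n eq = <-irrefl (sym k≡0) 0<k
    where
    o : Fin n
    o = 0 mod n
    toℕ-o : toℕ o ≡ 0
    toℕ-o = trans (toℕ-mod 0) (m<n⇒m%n≡m (>-nonZero⁻¹ n))
    fixed : rot k o ≡ o
    fixed with l , _ , l-o ← rot-transitive i o =
      subst (λ z → rot k z ≡ z) l-o (trans (rot-comm k l i) (cong (rot l) eq))
    k≡0 : k ≡ 0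
    k≡0 = begin
      k              ≡⟨ m<n⇒m%n≡m k<n ⟨
      k % n          ≡⟨ cong (λ x → (x + k) % n) toℕ-o ⟨
      (toℕ o + k) % n ≡⟨ toℕ-rot k o ⟨
      toℕ (rot k o)  ≡⟨ cong toℕ fixed ⟩
      toℕ o          ≡⟨ toℕ-o ⟩
      0              ∎
      where open ≡-Reasoning

  -- What `nextRelated` computes, freed from the search. Offsets run from 1 to n, so i itself is met
  -- last; two such records with the same P and i have the same x, which is how equalities of
  -- successors are proved.
  record First (P : U.Pred (Fin n) 0ℓ) (i x : Fin n) : Set where
    field
      offset : ℕ
      0<offset : 0 < offset
      offset≤n : offset ≤ n
      reaches : rot offset i ≡ x
      holds : P x
      before : ∀ {s} → 0 < s → s < offset → ¬ P (rot s i)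

  module _ {P : U.Pred (Fin n) 0ℓ} where

    First-unique : ∀ {i x y} → First P i x → First P i y → x ≡ y
    First-unique {i} f g with <-cmp (First.offset f) (First.offset g)
    ... | tri< d<e _ _ = ⊥-elim (First.before g (First.0<offset f) d<e
                                   (subst P (sym (First.reaches f)) (First.holds f)))
    ... | tri≈ _ d≡e _ = trans (sym (First.reaches f))
                           (trans (cong (λ d → rot d i) d≡e) (First.reaches g))
    ... | tri> _ _ e<d = ⊥-elim (First.before f (First.0<offset g) e<d
                                   (subst P (sym (First.reaches g)) (First.holds g)))

    First-map : ∀ {Q : U.Pred (Fin n) 0ℓ} (f : Fin n → Fin n) →
                (∀ z → f (rotate z) ≡ rotate (f z)) → (∀ z → P z ⇔ Q (f z)) →
                ∀ {i x} → First P i x → First Q (f i) (f x)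
    First-map {Q} f f-rotate P⇔Q {i} fst = record
      { offset = F.offset
      ; 0<offset = F.0<offset
      ; offset≤n = F.offset≤n
      ; reaches = trans (sym (fold-map f f-rotate F.offset)) (cong f F.reaches)
      ; holds = Equivalence.to (P⇔Q _) F.holds
      ; before = λ {s} 0<s s<d q → F.before 0<s s<d
          (Equivalence.from (P⇔Q _) (subst Q (sym (fold-map f f-rotate s)) q))
      }
      where module F = First fst

    -- A known hit within the fuel guarantees that the default value of `search` at fuel zero is
    -- returned only where it is itself a hit.
    search-spec : (P? : U.Decidable P) → ∀ k l i → l ≤ k → P (rot l i) →
                  ∃[ d ] (d ≤ l × search P? k i ≡ rot d i × P (rot d i) ×
                          (∀ {s} → s < d → ¬ P (rot s i)))
    search-spec P? zero zero i l≤k p = 0 , z≤n , refl , p , λ ()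
    search-spec P? (suc k) l i l≤k p with P? i
    ... | yes pi = 0 , z≤n , refl , pi , λ ()
    search-spec P? (suc k) zero i l≤k p | no ¬pi = ⊥-elim (¬pi p)
    search-spec P? (suc k) (suc l) i (s≤s l≤k) p | no ¬pi
      with d , d≤l , eq , pd , bef ← search-spec P? k l (rotate i) l≤k (subst P (sym (rot-rotate l i)) p)
      = suc d , s≤s d≤l , trans eq (rot-rotate d i) , subst P (rot-rotate d i) pd ,
        λ { {zero} _ → ¬pi ; {suc s} (s≤s s<d) → λ q → bef s<d (subst P (sym (rot-rotate s i)) q) }

  module _ {_∼_ : Rel (Fin n) 0ℓ} (isEquivalence : IsEquivalence _∼_) (_∼?_ : Decidable _∼_) where
    private module E = IsEquivalence isEquivalence

    nextRelated-First : ∀ i → First (i ∼_) i (nextRelated _∼?_ i)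
    nextRelated-First i
      -- From `rotate i`, another n ∸ 1 steps lead back to i, which is related to itself.
      with d , d≤ , eq , p , bef ← search-spec (i ∼?_) n (n ∸ 1) (rotate i) (m∸n≤m n 1)
             (E.reflexive (sym (trans (sym (rotate⁻¹-rot (rotate i))) (rotate⁻¹-rotate i))))
      = record
      { offset = suc d
      ; 0<offset = z<s
      ; offset≤n = ≤-trans (s≤s d≤) (≤-reflexive (m+[n∸m]≡n (>-nonZero⁻¹ n)))
      ; reaches = trans (sym (rot-rotate d i)) (sym eq)
      ; holds = subst (i ∼_) (sym eq) p
      ; before = λ { {suc s} _ (s≤s s<d) q → bef s<d (subst (i ∼_) (sym (rot-rotate s i)) q) }
      }

    nextRelated-related : ∀ i → nextRelated _∼?_ i ∼ i
    nextRelated-related i = E.sym (First.holds (nextRelated-First i))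

    private
      -- Induction on the clockwise distance from i to j: the successor of i does not lie beyond j,
      -- and passing to it shortens the distance by a positive offset.
      cyclic : ∀ {d} → Acc _<_ d → ∀ {i j} → rot d i ≡ j → i ∼ j →
               ∃[ k ] fold i (nextRelated _∼?_) k ≡ j
      cyclic {zero} _ eq _ = 0 , eq
      cyclic {d@(suc _)} (acc rec) {i} {j} eq i∼j with First.offset (nextRelated-First i) ≤? d
      ... | no c≰d = ⊥-elim (First.before (nextRelated-First i) z<s (≰⇒> c≰d)
                               (subst (i ∼_) (sym eq) i∼j))
      ... | yes c≤d =
        let module F = First (nextRelated-First i)
            shorter : rot (d ∸ F.offset) (nextRelated _∼?_ i) ≡ j
            shorter = begin
              rot (d ∸ F.offset) (nextRelated _∼?_ i) ≡⟨ cong (rot (d ∸ F.offset)) F.reaches ⟨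
              rot (d ∸ F.offset) (rot F.offset i)     ≡⟨ rot-+ (d ∸ F.offset) F.offset i ⟨
              rot (d ∸ F.offset + F.offset) i         ≡⟨ cong (λ x → rot x i) (m∸n+n≡m c≤d) ⟩
              rot d i                                 ≡⟨ eq ⟩
              j                                       ∎
            k , eq′ = cyclic (rec (∸-monoʳ-< F.0<offset c≤d)) shorter
                        (E.trans (nextRelated-related i) i∼j)
        in suc k , trans (sym (fold-suc (nextRelated _∼?_) k)) eq′
        where open ≡-Reasoning

    nextRelated-cyclic : ∀ {i j} → i ∼ j → ∃[ k ] fold i (nextRelated _∼?_) k ≡ j
    nextRelated-cyclic {i} {j} i∼j with d , _ , eq ← rot-transitive i j =
      cyclic (<-wellFounded d) eq i∼j

-- The product of the periods of x and y is a period of both, and from the first step on their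
-- iterates agree.
periodic⇒injective : ∀ {A : Set} (s : A → A) → (∀ z → ∃[ k ] fold z s (suc k) ≡ z) →
                     ∀ {x y} → s x ≡ s y → x ≡ y
periodic⇒injective s period {x} {y} eq with k , x-k ← period x | l , y-l ← period y = begin
  x                      ≡⟨ fold-period s (suc k) x-k (suc l) ⟨
  fold x s (suc l * suc k) ≡⟨ fold-suc s (k + l * suc k) ⟨
  fold (s x) s (k + l * suc k) ≡⟨ cong (λ z → fold z s (k + l * suc k)) eq ⟩
  fold (s y) s (k + l * suc k) ≡⟨ fold-suc s (k + l * suc k) ⟩
  fold y s (suc l * suc k) ≡⟨ cong (fold y s) (*-comm (suc l) (suc k)) ⟩
  fold y s (suc k * suc l) ≡⟨ fold-period s (suc l) y-l (suc k) ⟩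
  y ∎
  where open ≡-Reasoning

-- Identities of exclusive or

xor-cancel-common : ∀ a b k l q → ((a xor k) xor q) xor ((b xor l) xor q) ≡ (a xor b) xor (k xor l)
xor-cancel-common = solve 5 (λ a b k l q → ((a :+ k) :+ q) :+ ((b :+ l) :+ q) := (a :+ b) :+ (k :+ l)) refl
  where open xor-∧-Solver

xor-telescope : ∀ a b c → a xor c ≡ (a xor b) xor (b xor c)
xor-telescope = solve 3 (λ a b c → a :+ c := (a :+ b) :+ (b :+ c)) refl
  where open xor-∧-Solver

xor-xor-same : ∀ a b → (a xor b) xor b ≡ a
xor-xor-same = solve 2 (λ a b → (a :+ b) :+ b := a) refl
  where open xor-∧-Solver

module _ {m : ℕ} where

  rotate-last : ∀ {i : Fin (suc m)} → toℕ i ≡ m → rotate i ≡ zero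
  rotate-last {i} i≡m = Fin.toℕ-injective (begin
    toℕ (rotate i)      ≡⟨ toℕ-rot 1 i ⟩
    (toℕ i + 1) % suc m ≡⟨ cong (λ x → (x + 1) % suc m) i≡m ⟩
    (m + 1) % suc m     ≡⟨ cong (_% suc m) (+-comm m 1) ⟩
    suc m % suc m       ≡⟨ n%n≡0 (suc m) ⟩
    0                   ∎)
    where open ≡-Reasoning

  rotate-notLast : ∀ {i : Fin (suc m)} → toℕ i ≢ m → toℕ (rotate i) ≡ suc (toℕ i)
  rotate-notLast {i} i≢m =
    trans (toℕ-rot-< 1 i (subst (_< suc m) (+-comm 1 (toℕ i)) (s≤s (≤∧≢⇒< (Fin.toℕ≤pred[n] i) i≢m))))
          (+-comm (toℕ i) 1)

  rot-∸ : ∀ {i j : Fin (suc m)} → toℕ i ≤ toℕ j → rot (toℕ j ∸ toℕ i) i ≡ j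
  rot-∸ {i} {j} i≤j = Fin.toℕ-injective (trans
    (toℕ-rot-< _ i (subst (_< suc m) (sym (m+[n∸m]≡n i≤j)) (Fin.toℕ<n j))) (m+[n∸m]≡n i≤j))

  -- White regions

  above : (i p : Fin (suc m)) → Bool
  above i p = toℕ i <ᵇ toℕ p

  private
    <⇒above : ∀ {i p : Fin (suc m)} → toℕ i < toℕ p → above i p ≡ true
    <⇒above {i} {p} i<p = dec-true (toℕ i <? toℕ p) i<p

    ≤⇒¬above : ∀ {i p : Fin (suc m)} → toℕ p ≤ toℕ i → above i p ≡ false
    ≤⇒¬above {i} {p} p≤i = dec-false (toℕ i <? toℕ p) (≤⇒≯ p≤i)

  -- A Boolean form of `OneSide`. With exclusive or, transitivity and rotation invariance of white
  -- regions become Boolean identities.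
  side : (i j p : Fin (suc m)) → Bool
  side i j p = above i p xor above j p

  OneSide⇔side : ∀ {i j p} → OneSide i j p ⇔ side i j p ≡ true
  OneSide⇔side {i} {j} {p} = mk⇔ to from
    where
    to : OneSide i j p → side i j p ≡ true
    to (inj₁ (i<p , p≤j)) = cong₂ _xor_ (<⇒above {i} i<p) (≤⇒¬above {j} p≤j)
    to (inj₂ (j<p , p≤i)) = cong₂ _xor_ (≤⇒¬above {i} p≤i) (<⇒above {j} j<p)
    from : side i j p ≡ true → OneSide i j p
    from eq with toℕ i <? toℕ p | toℕ j <? toℕ p
    ... | yes i<p | no j≮p = inj₁ (i<p , ≮⇒≥ j≮p)
    ... | no i≮p | yes j<p = inj₂ (j<p , ≮⇒≥ i≮p)
    ... | yes i<p | yes j<p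
      with () ← trans (sym eq) (cong₂ _xor_ (<⇒above {i} i<p) (<⇒above {j} j<p))
    ... | no i≮p | no j≮p
      with () ← trans (sym eq) (cong₂ _xor_ (≤⇒¬above {i} (≮⇒≥ i≮p)) (≤⇒¬above {j} (≮⇒≥ j≮p)))

  side-trans : ∀ i j k p → side i k p ≡ side i j p xor side j k p
  side-trans i j k p = xor-telescope (above i p) (above j p) (above k p)

  private
    last : Fin (suc m) → Bool
    last i = toℕ i ≡ᵇ m

    -- Rotation affects the comparison only by wrapping from m to 0, and each of the two possible
    -- wraps flips it once.
    above-rotate : ∀ i p → above (rotate i) (rotate p) ≡ (above i p xor last i) xor last p
    above-rotate i p with toℕ i ≟ m | toℕ p ≟ m
    ... | yes i≡m | yes p≡m
      rewrite dec-true (toℕ i ≟ m) i≡m | dec-true (toℕ p ≟ m) p≡m | rotate-last {p} p≡m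
            | ≤⇒¬above {i} {p} (≤-reflexive (trans p≡m (sym i≡m))) = refl
    ... | yes i≡m | no p≢m
      rewrite dec-true (toℕ i ≟ m) i≡m | dec-false (toℕ p ≟ m) p≢m | rotate-last {i} i≡m
            | rotate-notLast {p} p≢m
            | ≤⇒¬above {i} {p} (subst (toℕ p ≤_) (sym i≡m) (Fin.toℕ≤pred[n] p)) = refl
    ... | no i≢m | yes p≡m
      rewrite dec-false (toℕ i ≟ m) i≢m | dec-true (toℕ p ≟ m) p≡m | rotate-last {p} p≡m
            | <⇒above {i} {p} (subst (toℕ i <_) (sym p≡m) (≤∧≢⇒< (Fin.toℕ≤pred[n] i) i≢m)) = refl
    ... | no i≢m | no p≢m
      rewrite dec-false (toℕ i ≟ m) i≢m | dec-false (toℕ p ≟ m) p≢m | rotate-notLast {p} p≢m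
            | rotate-notLast {i} i≢m =
      sym (xor-xor-same (above i p) false)

  -- The correction does not involve p: rotating may exchange the names of the two sides of a cut,
  -- but for all points at once.
  side-rotate : ∀ i j p → side (rotate i) (rotate j) (rotate p) ≡ side i j p xor (last i xor last j)
  side-rotate i j p = trans (cong₂ _xor_ (above-rotate i p) (above-rotate j p))
    (xor-cancel-common (above i p) (above j p) (last i) (last j) (last p))

  module _ (π : NoncrossingPartition (suc m)) where
    open NoncrossingPartition π
    private module ∼ = IsDecEquivalence isDecEquivalence

    -- As `∼` is symmetric, the one-way implication between sides amounts to an equality of
    -- Booleans.
    SameWhiteRegion⇔side : ∀ {i j} → SameWhiteRegion π i j ⇔ (∀ p q → p ∼ q → side i j p ≡ side i j q)
    SameWhiteRegion⇔side = mk⇔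
      (λ same p q p∼q → ⇔→≡ {z = true} (mk⇔
        (λ eq → Equivalence.to OneSide⇔side (same p q p∼q (Equivalence.from OneSide⇔side eq)))
        (λ eq → Equivalence.to OneSide⇔side (same q p (∼.sym p∼q) (Equivalence.from OneSide⇔side eq)))))
      (λ same p q p∼q one → Equivalence.from OneSide⇔side
        (trans (sym (same p q p∼q)) (Equivalence.to OneSide⇔side one)))

    sameRegion-isEquivalence : ∀ c → IsEquivalence (SameRegion π c)
    sameRegion-isEquivalence yellow = ∼.isEquivalence
    sameRegion-isEquivalence white = record
      { refl = λ {i} → Equivalence.from SameWhiteRegion⇔side λ p q _ →
          trans (xor-same (above i p)) (sym (xor-same (above i q)))
      ; sym = λ same p q p∼q → λ { (inj₁ x) → swap (same p q p∼q (inj₂ x))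
                                 ; (inj₂ x) → swap (same p q p∼q (inj₁ x)) }
      ; trans = λ {i} {j} {k} same₁ same₂ → Equivalence.from SameWhiteRegion⇔side λ p q p∼q → begin
          side i k p                ≡⟨ side-trans i j k p ⟩
          side i j p xor side j k p ≡⟨ cong₂ _xor_ (Equivalence.to SameWhiteRegion⇔side same₁ p q p∼q)
                                                   (Equivalence.to SameWhiteRegion⇔side same₂ p q p∼q) ⟩
          side i j q xor side j k q ≡⟨ side-trans i j k q ⟨
          side i k q                ∎
      }
      where
      open ≡-Reasoning
      swap : ∀ {i j p : Fin (suc m)} → OneSide i j p → OneSide j i p
      swap (inj₁ x) = inj₂ x
      swap (inj₂ x) = inj₁ x

    nextSide : Colour → Fin (suc m) → Fin (suc m)
    nextSide = BicoloredPlaneGraph.next (𝒯 π)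

    next-First : ∀ c i → First (SameRegion π c i) i (nextSide c i)
    next-First c = nextRelated-First (sameRegion-isEquivalence c) (sameRegion? π c)

    next-related : ∀ c i → SameRegion π c (nextSide c i) i
    next-related c = nextRelated-related (sameRegion-isEquivalence c) (sameRegion? π c)

    next-transitive : ∀ c {i j} → SameRegion π c i j → ∃[ k ] fold i (nextSide c) k ≡ j
    next-transitive c = nextRelated-cyclic (sameRegion-isEquivalence c) (sameRegion? π c)

    next-periodic : ∀ c i → ∃[ k ] fold i (nextSide c) (suc k) ≡ i
    next-periodic c i =
      let k , eq = next-transitive c (next-related c i) in k , trans (sym (fold-suc (nextSide c) k)) eq

    next-injective : ∀ c {i j} → nextSide c i ≡ nextSide c j → i ≡ j
    next-injective c = periodic⇒injective (nextSide c) (next-periodic c)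

    rotateNoncrossing : NoncrossingPartition (suc m)
    rotateNoncrossing = record { partition = R partition ; noncrossing = nc }
      where
      dec-< : ∀ {x y : Fin (suc m)} → toℕ (rotate x) ≢ 0 → toℕ (rotate x) < toℕ (rotate y) → toℕ x < toℕ y
      dec-< {x} {y} x′≢0 x′<y′ = s<s⁻¹ (subst₂ _<_ (notLast x′≢0) (notLast (>⇒≢ (≤-<-trans z≤n x′<y′))) x′<y′)
        where
        notLast : ∀ {z} → toℕ (rotate z) ≢ 0 → toℕ (rotate z) ≡ suc (toℕ z)
        notLast z′≢0 = rotate-notLast λ z≡m → z′≢0 (cong toℕ (rotate-last z≡m))

      rotated : ∀ {a b c d} → toℕ (rotate a) < toℕ (rotate b) → toℕ (rotate b) < toℕ (rotate c) →
                toℕ (rotate c) < toℕ (rotate d) → ¬ (a ∼ c × b ∼ d × ¬ (a ∼ b))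
      rotated {a} {b} {c} {d} a<b b<c c<d (a∼c , b∼d , a≁b) with toℕ a ≟ m
      ... | no a≢m =
        noncrossing (dec-< (λ a′≡0 → 0≢1+n (trans (sym a′≡0) (rotate-notLast a≢m))) a<b)
          (dec-< (>⇒≢ (≤-<-trans z≤n a<b)) b<c) (dec-< (>⇒≢ (≤-<-trans z≤n b<c)) c<d) (a∼c , b∼d , a≁b)
      -- Here a is the last point and rotates to 0, so the crossing is read in the order b < c < d <
      -- a.
      ... | yes a≡m =
        noncrossing (dec-< (>⇒≢ (≤-<-trans z≤n a<b)) b<c) (dec-< (>⇒≢ (≤-<-trans z≤n b<c)) c<d)
          (subst (toℕ d <_) (sym a≡m) (≤∧≢⇒< (Fin.toℕ≤pred[n] d)
            λ d≡m → <⇒≢ (<-trans a<b (<-trans b<c c<d))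
              (cong toℕ (trans (rotate-last a≡m) (sym (rotate-last d≡m))))))
          (b∼d , ∼.sym a∼c , λ b∼c → a≁b (∼.trans a∼c (∼.sym b∼c)))

      nc : Noncrossing (R partition)
      nc a<b b<c c<d = rotated (lift< a<b) (lift< b<c) (lift< c<d)
        where
        lift< : ∀ {x y : Fin (suc m)} → toℕ x < toℕ y → toℕ (rotate (rotate⁻¹ x)) < toℕ (rotate (rotate⁻¹ y))
        lift< {x} {y} = subst₂ (λ u v → toℕ u < toℕ v) (sym (rotate-rotate⁻¹ x)) (sym (rotate-rotate⁻¹ y))

  -- The case in which side i ends at point 0, so that the cut along it
  -- separates a final segment of the points and arcs from the rest.
  module _ (π : NoncrossingPartition (suc m)) {i} (next-i : nextSide π yellow i ≡ zero) where
    open NoncrossingPartition π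
    private
      module ∼ = IsDecEquivalence isDecEquivalence

      i∼0 : i ∼ zero
      i∼0 = subst (i ∼_) next-i (∼.sym (next-related π yellow i))

      -- Point 0 is the first point of the block met after i, and p would be met earlier.
      last-in-block : ∀ {p} → toℕ i < toℕ p → ¬ (i ∼ p)
      last-in-block {p} i<p i∼p = F.before (m<n⇒0<n∸m i<p) p-i<offset (subst (i ∼_) (sym (rot-∸ (<⇒≤ i<p))) i∼p)
        where
        module F = First (next-First π yellow i)
        i+[p-i] : toℕ i + (toℕ p ∸ toℕ i) ≡ toℕ p
        i+[p-i] = m+[n∸m]≡n (<⇒≤ i<p)
        p-i<offset : toℕ p ∸ toℕ i < F.offset
        p-i<offset = ≰⇒> λ offset≤ → <⇒≢ (<-≤-trans F.0<offset (m≤n+m F.offset (toℕ i))) (begin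
          0                        ≡⟨ cong toℕ (trans F.reaches next-i) ⟨
          toℕ (rot F.offset i)     ≡⟨ toℕ-rot-< F.offset i (≤-<-trans (≤-trans (+-monoʳ-≤ (toℕ i) offset≤)
                                        (≤-reflexive i+[p-i])) (Fin.toℕ<n p)) ⟩
          toℕ i + F.offset         ∎)
          where open ≡-Reasoning

    -- The block of i has no point beyond i, and another block with points on both sides of i would
    -- cross it at 0 < q < i < p.
    above-block : ∀ {p q} → p ∼ q → toℕ i < toℕ p → toℕ i < toℕ q
    above-block {p} {q} p∼q i<p with <-cmp (toℕ i) (toℕ q)
    ... | tri< i<q _ _ = i<q
    ... | tri≈ _ i≡q _ = ⊥-elim (last-in-block i<p
                           (subst (_∼ p) (sym (Fin.toℕ-injective i≡q)) (∼.sym p∼q)))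
    above-block {p} {zero} p∼0 i<p | tri> _ _ _ = ⊥-elim (last-in-block i<p (∼.trans i∼0 (∼.sym p∼0)))
    above-block {p} {q@(suc _)} p∼q i<p | tri> _ _ q<i =
      ⊥-elim (noncrossing {zero} {q} {i} {p} z<s q<i i<p (∼.sym i∼0 , ∼.sym p∼q ,
        λ 0∼q → last-in-block i<p (∼.trans i∼0 (∼.trans 0∼q (∼.sym p∼q)))))

    -- The block of i and 0 has points on both sides of the cut: i lies on the side away from 0.
    separates : ∀ {a a′} → toℕ i ≤ toℕ a → toℕ a′ < toℕ i → ¬ SameWhiteRegion π a a′
    separates i≤a a′<i same with same i zero i∼0 (inj₂ (a′<i , i≤a))
    ... | inj₁ (() , _)
    ... | inj₂ (() , _)

    -- No block straddles the cut from arc l to arc i, by `above-block`, while the arcs 0, ..., i-1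
    -- met earlier are cut off by the block of i and 0.
    next-white-last : ∀ {l} → toℕ l ≡ m → nextSide π white l ≡ i
    next-white-last {l} l≡m = First-unique (next-First π white l) (record
      { offset = suc (toℕ i)
      ; 0<offset = z<s
      ; offset≤n = Fin.toℕ<n i
      ; reaches = trans (rot-l (toℕ i)) (Fin.toℕ-injective (toℕ-rot-< (toℕ i) zero (Fin.toℕ<n i)))
      ; holds = same
      ; before = λ { {suc s} _ (s≤s s<i) same′ → separates (subst (toℕ i ≤_) (sym l≡m) (Fin.toℕ≤pred[n] i))
          (subst (_< toℕ i) (sym (trans (cong toℕ (rot-l s)) (toℕ-rot-< s zero (<-trans s<i (Fin.toℕ<n i))))) s<i)
          same′ }
      })
      where
      rot-l : ∀ s → rot (suc s) l ≡ rot s zero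
      rot-l s = trans (sym (rot-rotate s l)) (cong (rot s) (rotate-last l≡m))
      ≤l : ∀ q → toℕ q ≤ toℕ l
      ≤l q = subst (toℕ q ≤_) (sym l≡m) (Fin.toℕ≤pred[n] q)
      same : SameWhiteRegion π l i
      same p q p∼q (inj₁ (l<p , _)) = ⊥-elim (<⇒≱ l<p (≤l p))
      same p q p∼q (inj₂ (i<p , _)) = inj₂ (above-block p∼q i<p , ≤l q)

  module _ (π : NoncrossingPartition (suc m)) where
    open NoncrossingPartition π

    SameRegion-rotate : ∀ c {i j} → SameRegion π c i j ⇔ SameRegion (rotateNoncrossing π) c (rotate i) (rotate j)
    SameRegion-rotate yellow {i} {j} = mk⇔
      (subst₂ _∼_ (sym (rotate⁻¹-rotate i)) (sym (rotate⁻¹-rotate j)))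
      (subst₂ _∼_ (rotate⁻¹-rotate i) (rotate⁻¹-rotate j))
    SameRegion-rotate white {i} {j} = mk⇔
      (λ same → from′ λ p q p∼q →
        subst₂ (λ u v → side (rotate i) (rotate j) u ≡ side (rotate i) (rotate j) v)
          (rotate-rotate⁻¹ p) (rotate-rotate⁻¹ q)
          (trans (side-rotate i j (rotate⁻¹ p))
            (trans (cong (_xor (last i xor last j)) (to same _ _ p∼q)) (sym (side-rotate i j (rotate⁻¹ q))))))
      (λ same → from λ p q p∼q → begin
        side i j p                    ≡⟨ undo (side-rotate i j p) ⟩
        side (rotate i) (rotate j) (rotate p) xor (last i xor last j)
          ≡⟨ cong (_xor (last i xor last j)) (to′ same (rotate p) (rotate q) (Equivalence.to (SameRegion-rotate yellow) p∼q)) ⟩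
        side (rotate i) (rotate j) (rotate q) xor (last i xor last j) ≡⟨ undo (side-rotate i j q) ⟨
        side i j q ∎)
      where
      open ≡-Reasoning
      open Equivalence (SameWhiteRegion⇔side π {i} {j})
      open Equivalence (SameWhiteRegion⇔side (rotateNoncrossing π) {rotate i} {rotate j})
        using () renaming (to to to′; from to from′)
      undo : ∀ {a b c} → a ≡ b xor c → b ≡ a xor c
      undo {_} {b} {c} refl = sym (xor-xor-same b c)

    next-rotate : ∀ c i → nextSide (rotateNoncrossing π) c (rotate i) ≡ rotate (nextSide π c i)
    next-rotate c i = First-unique (next-First (rotateNoncrossing π) c (rotate i))
      (First-map rotate (λ _ → refl) (λ _ → SameRegion-rotate c) (next-First π c i))

  -- The white rotation is the Kreweras complement of the yellow one.  Rotating
  -- the diagram reduces this to the last arc, after which comes point 0.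
  next-yellow-white : ∀ π i → nextSide π yellow (nextSide π white i) ≡ rotate i
  next-yellow-white π i =
    let k , _ , eq = rot-transitive i (fromℕ m) in from-last k (trans (cong toℕ eq) (Fin.toℕ-fromℕ m)) π
    where
    from-last : ∀ k {i} → toℕ (rot k i) ≡ m → ∀ π → nextSide π yellow (nextSide π white i) ≡ rotate i
    from-last zero i≡m π =
      -- The last iterate before the return to 0 is a side ending at point 0, as the special case
      -- requires.
      let k , next-j = next-periodic π yellow zero in
      trans (cong (nextSide π yellow) (next-white-last π next-j i≡m)) (trans next-j (sym (rotate-last i≡m)))
    from-last (suc k) {i} eq π = rotate-injective (begin
      rotate (nextSide π yellow (nextSide π white i))       ≡⟨ next-rotate π yellow _ ⟨
      nextSide π′ yellow (rotate (nextSide π white i))      ≡⟨ cong (nextSide π′ yellow) (next-rotate π white i) ⟨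
      nextSide π′ yellow (nextSide π′ white (rotate i))     ≡⟨ from-last k (trans (cong toℕ (rot-rotate k i)) eq) π′ ⟩
      rotate (rotate i)                             ∎)
      where
      open ≡-Reasoning
      π′ = rotateNoncrossing π

  -- S is the set of the vertices of one of the two components left when side i
  -- is deleted from the tree.
  record Bridge (π : NoncrossingPartition (suc m)) (i : Fin (suc m)) : Set₁ where
    field
      S : Colour → Fin (suc m) → Set
      resp : ∀ c {a b} → SameRegion π c a b → S c a → S c b
      white∈S : S white i
      yellow∉S : ¬ S yellow i
      across : ∀ c {e} → e ≢ i → S c e → S (opposite c) e

  -- If side i ends at point 0, then S consists of the points after i and the arcs from i on;
  -- `above-block` and `separates` show that no region straddles this cut. Rotation reduces every
  -- side to that case.
  bridge : ∀ π i → Bridge π i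
  bridge π i = let k , _ , eq = rot-transitive (nextSide π yellow i) zero in from-zero k π eq
    where
    from-zero : ∀ k π {i} → rot k (nextSide π yellow i) ≡ zero → Bridge π i
    from-zero zero π {i} next-i = record
      { S = S₀
      ; resp = λ { yellow → above-block π next-i
                 ; white same i≤a → ≮⇒≥ λ b<i → separates π next-i i≤a b<i same }
      ; white∈S = ≤-refl
      ; yellow∉S = <-irrefl refl
      ; across = λ { yellow e≢i → <⇒≤
                   ; white e≢i i≤e → ≤∧≢⇒< i≤e λ i≡e → e≢i (sym (Fin.toℕ-injective i≡e)) }
      }
      where
      S₀ : Colour → Fin (suc m) → Set
      S₀ yellow p = toℕ i < toℕ p
      S₀ white  a = toℕ i ≤ toℕ a
    from-zero (suc k) π {i} eq = record
      { S = λ c a → B.S c (rotate a)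
      ; resp = λ c same → B.resp c (Equivalence.to (SameRegion-rotate π c) same)
      ; white∈S = B.white∈S
      ; yellow∉S = B.yellow∉S
      ; across = λ c e≢i → B.across c (λ eq → e≢i (rotate-injective eq))
      }
      where
      module B = Bridge (from-zero k (rotateNoncrossing π) {rotate i}
        (trans (cong (rot k) (next-rotate π yellow i)) (trans (rot-rotate k _) eq)))

-- Colours and walks

≢⇒≡opposite : ∀ {c d} → c ≢ d → c ≡ opposite d
≢⇒≡opposite {white}  {white}  c≢d = ⊥-elim (c≢d refl)
≢⇒≡opposite {white}  {yellow} c≢d = refl
≢⇒≡opposite {yellow} {white}  c≢d = refl
≢⇒≡opposite {yellow} {yellow} c≢d = ⊥-elim (c≢d refl)

_≟ᶜ_ : DecidableEquality Colour
white  ≟ᶜ white  = yes refl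
white  ≟ᶜ yellow = no λ ()
yellow ≟ᶜ white  = no λ ()
yellow ≟ᶜ yellow = yes refl

module _ {n : ℕ} {G : BicoloredPlaneGraph n} (isTransitive : Transitive (BicoloredPlaneGraph._≈_ G)) where
  open BicoloredPlaneGraph G

  restart : ∀ {u v w} → u ≈ v → Walk G v w → Walk G u w
  restart u≈v (stop v≈w)      = stop (isTransitive u≈v v≈w)
  restart u≈v (step c e v≈ p) = step c e (isTransitive u≈v v≈) p

  edges-restart : ∀ {u v w} (u≈v : u ≈ v) (p : Walk G v w) → edges G (restart u≈v p) ≡ edges G p
  edges-restart u≈v (stop _)       = refl
  edges-restart u≈v (step _ _ _ _) = refl

-- The tree of a noncrossing partition

module _ {m : ℕ} (π : NoncrossingPartition (suc m)) where
  open BicoloredPlaneGraph (𝒯 π)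
  private
    module Same c = IsEquivalence (sameRegion-isEquivalence π c)

  ≈-isDecEquivalence : IsDecEquivalence _≈_
  ≈-isDecEquivalence = record
    { isEquivalence = record
      { refl = λ {v} → refl , Same.refl (proj₁ v)
      ; sym = λ { {c , _} (refl , same) → refl , Same.sym c same }
      ; trans = λ { {c , _} (refl , same₁) (refl , same₂) → refl , Same.trans c same₁ same₂ }
      }
    ; _≟_ = decide
    }
    where
    decide : Decidable _≈_
    decide (c , i) (d , j) with c ≟ᶜ d
    ... | no c≢d = no λ v≈w → c≢d (proj₁ v≈w)
    ... | yes c≡d = map′ (c≡d ,_) proj₂ (sameRegion? π c i j)

  private
    module ≈ = IsDecEquivalence ≈-isDecEquivalence

    -- Two steps lead from the block of i to that of `rotate i`: cross side i to its white region,
    -- then cross the next side around that region, by `next-yellow-white`.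
    walk-rot : ∀ k {i w} → Walk (𝒯 π) (yellow , rot k i) w → Walk (𝒯 π) (yellow , i) w
    walk-rot zero        p = p
    walk-rot (suc k) {i} {w} p =
      step yellow i ≈.refl (step white (nextSide π white i) (refl , Same.sym white (next-related π white i))
        (restart ≈.trans (refl , Same.sym yellow rotate-i∼)
          (walk-rot k (subst (λ x → Walk (𝒯 π) (yellow , x) w) (sym (rot-rotate k i)) p))))
      where
      rotate-i∼ : SameRegion π yellow (rotate i) (nextSide π white i)
      rotate-i∼ = subst (λ x → SameRegion π yellow x (nextSide π white i)) (next-yellow-white π i)
        (next-related π yellow (nextSide π white i))

    connect-yellow : ∀ i w → Walk (𝒯 π) (yellow , i) w
    connect-yellow i (yellow , j) with k , _ , eq ← rot-transitive i j =
      walk-rot k (stop (refl , Same.reflexive yellow eq))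
    connect-yellow i (white , j) with k , _ , eq ← rot-transitive i j =
      walk-rot k (step yellow j (refl , Same.reflexive yellow eq) (stop ≈.refl))

    connect : ∀ v w → Walk (𝒯 π) v w
    connect (yellow , i) w = connect-yellow i w
    connect (white , i)  w = step white i ≈.refl (connect-yellow i w)

    module _ {i} (b : Bridge π i) where
      open Bridge b
      S⁺ : V → Set
      S⁺ (c , a) = S c a

      S-resp : ∀ {v w} → v ≈ w → S⁺ v → S⁺ w
      S-resp {c , _} (refl , same) = resp c same

      across⁻ : ∀ c {e} → e ≢ i → S (opposite c) e → S c e
      across⁻ white  = across yellow
      across⁻ yellow = across white

      -- Only edge i joins S to its complement.
      S-walk : ∀ {v w} (p : Walk (𝒯 π) v w) → All (i ≢_) (edges (𝒯 π) p) → S⁺ v → S⁺ w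
      S-walk (stop v≈w) _ s = S-resp v≈w s
      S-walk (step c e v≈ p) (i≢e ∷ i∉p) s = S-walk p i∉p (across c (λ e≡i → i≢e (sym e≡i)) (S-resp v≈ s))

      S-walk⁻ : ∀ {v w} (p : Walk (𝒯 π) v w) → All (i ≢_) (edges (𝒯 π) p) → S⁺ w → S⁺ v
      S-walk⁻ (stop v≈w) _ s = S-resp (≈.sym v≈w) s
      S-walk⁻ (step c e v≈ p) (i≢e ∷ i∉p) s =
        S-resp (≈.sym v≈) (across⁻ c (λ e≡i → i≢e (sym e≡i)) (S-walk⁻ p i∉p s))

    -- After its first edge i, a cycle continues from one end of i to the other without using i
    -- again, but deleting i separates these ends.
    no-cycle : ∀ {v} (p : Walk (𝒯 π) v v) → ¬ IsCycle (𝒯 π) p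
    no-cycle (stop _) (nonempty , _) = nonempty refl
    no-cycle (step white i v≈ p) (_ , i∉p ∷ _ , _) =
      yellow∉S (S-walk⁻ b p i∉p (S-resp b (≈.sym v≈) white∈S))
      where
      b = bridge π i
      open Bridge b
    no-cycle (step yellow i v≈ p) (_ , i∉p ∷ _ , _) =
      yellow∉S (S-resp b v≈ (S-walk b p i∉p white∈S))
      where
      b = bridge π i
      open Bridge b

  𝒯-isTree : IsBicoloredPlaneTree (𝒯 π)
  𝒯-isTree = record
    { isDecEquivalence = ≈-isDecEquivalence
    ; finite = suc m + suc m , enum , enum-surjective
    ; colour-cong = proj₁
    ; end-colour = λ c e → refl
    ; next-end = λ c e → refl , next-related π c e
    ; next-cyclic = λ c e≈f → next-transitive π c (proj₂ e≈f)
    ; connected = connect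
    ; acyclic = no-cycle
    }
    where
    enum : Fin (suc m + suc m) → V
    enum k = [ white ,_ , yellow ,_ ]′ (splitAt (suc m) k)
    enum-surjective : ∀ v → ∃[ k ] enum k ≈ v
    enum-surjective (white , i)  = i ↑ˡ suc m ,
      ≈.reflexive (cong [ white ,_ , yellow ,_ ]′ (Fin.splitAt-↑ˡ (suc m) i (suc m)))
    enum-surjective (yellow , i) = suc m ↑ʳ i ,
      ≈.reflexive (cong [ white ,_ , yellow ,_ ]′ (Fin.splitAt-↑ʳ (suc m) (suc m) i))

-- Walks in a tree

module _ {n : ℕ} {G : BicoloredPlaneGraph n} (isTree : IsBicoloredPlaneTree G) where
  open BicoloredPlaneGraph G
  open IsBicoloredPlaneTree isTree
  private
    module ≈ = IsDecEquivalence isDecEquivalence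

    -- Unlike `vertices`, this includes the last vertex, as simplicity of an open walk demands.
    visits : ∀ {v w} → Walk G v w → List V
    visits (stop {v} _)       = v ∷ []
    visits (step {v} _ _ _ p) = v ∷ visits p

    Simple : ∀ {v w} → Walk G v w → Set
    Simple p = AllPairs (λ x y → ¬ (x ≈ y)) (visits p)

    suffix : ∀ {u v w} (p : Walk G u w) → Simple p → Any (v ≈_) (visits p) →
             Σ[ q ∈ Walk G v w ] (Simple q × (∀ {e} → e ∈ edges G q → e ∈ edges G p))
    suffix (stop u≈w) s (here v≈u) = stop (≈.trans v≈u u≈w) , [] ∷ [] , λ ()
    suffix (step c e u≈ p) (u∉p ∷ s) (here v≈u) =
      step c e (≈.trans v≈u u≈) p , All.map (λ u≉x v≈x → u≉x (≈.trans (≈.sym v≈u) v≈x)) u∉p ∷ s , λ e∈ → e∈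
    suffix (step c e u≈ p) (_ ∷ s) (there v∈p) with q , s′ , sub ← suffix p s v∈p = q , s′ , λ e∈ → there (sub e∈)

    -- Loop erasure: if the simplified rest already visits v, the walk is cut short to start there.
    -- No new edges appear, so an avoided edge stays avoided.
    simplify : ∀ {v w} (p : Walk G v w) →
               Σ[ q ∈ Walk G v w ] (Simple q × (∀ {e} → e ∈ edges G q → e ∈ edges G p))
    simplify (stop v≈w) = stop v≈w , [] ∷ [] , λ e∈ → e∈
    simplify (step {v} c e v≈ p) with q , s , sub ← simplify p with any? (v ≈.≟_) (visits q)
    ... | yes v∈q with q′ , s′ , sub′ ← suffix q s v∈q = q′ , s′ , λ e∈ → there (sub (sub′ e∈))
    ... | no v∉q = step c e v≈ q , All.¬Any⇒All¬ _ v∉q ∷ s ,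
                   λ { (here eq) → here eq ; (there e∈) → there (sub e∈) }

    first-visit : ∀ {P : V → Set} {v w} (p : Walk G v w) → All P (visits p) → P v
    first-visit (stop _)       (pv ∷ _) = pv
    first-visit (step _ _ _ _) (pv ∷ _) = pv

    last-visit : ∀ {u v w} (p : Walk G v w) → All (λ x → ¬ (u ≈ x)) (visits p) → ¬ (u ≈ w)
    last-visit (stop v≈w)      (u≉v ∷ _) u≈w = u≉v (≈.trans u≈w (≈.sym v≈w))
    last-visit (step _ _ _ p) (_ ∷ u∉p)      = last-visit p u∉p

    visits⇒vertices : ∀ {P : V → Set} {v w} (p : Walk G v w) → All P (visits p) → All P (vertices G p)
    visits⇒vertices (stop _)       _          = []
    visits⇒vertices (step _ _ _ p) (pv ∷ ps) = pv ∷ visits⇒vertices p ps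

    -- With w in front, this is the vertex list of the closed walk that first steps from w to v.
    simple⇒distinct : ∀ {v w} (p : Walk G v w) → Simple p → AllPairs (λ x y → ¬ (x ≈ y)) (w ∷ vertices G p)
    simple⇒distinct (stop _) _ = [] ∷ []
    simple⇒distinct (step _ _ _ p) (v∉p ∷ s) with w∉p ∷ s′ ← simple⇒distinct p s =
      ((λ w≈v → last-visit p v∉p (≈.sym w≈v)) ∷ w∉p) ∷ visits⇒vertices p v∉p ∷ s′

    -- A walk using e visits both of its ends, and u is one of them.
    unvisited⇒unused : ∀ {u c e v w} → u ≈ end c e → (p : Walk G v w) →
                       All (λ x → ¬ (u ≈ x)) (visits p) → All (e ≢_) (edges G p)
    unvisited⇒unused _ (stop _) _ = []
    unvisited⇒unused {u} {c} {e} u≈ (step c′ e′ v≈ p) (u≉v ∷ u∉p) = e≢e′ ∷ unvisited⇒unused u≈ p u∉p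
      where
      e≢e′ : e ≢ e′
      e≢e′ refl with c ≟ᶜ c′
      ... | yes refl = u≉v (≈.trans u≈ (≈.sym v≈))
      ... | no c≢c′ = first-visit p u∉p (subst (λ d → u ≈ end d e) (≢⇒≡opposite c≢c′) u≈)

    simple⇒unique : ∀ {v w} (p : Walk G v w) → Simple p → Unique (edges G p)
    simple⇒unique (stop _) _ = []
    simple⇒unique (step c e v≈ p) (v∉p ∷ s) = unvisited⇒unused v≈ p v∉p ∷ simple⇒unique p s

  -- Otherwise loop erasure leaves a simple walk avoiding e, which e closes to a cycle.
  walk-uses-edge : ∀ {e} (p : Walk G (end white e) (end yellow e)) → ¬ (e ∉ edges G p)
  walk-uses-edge {e} p e∉p with q , s , sub ← simplify p =
    acyclic (step yellow e ≈.refl q)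
      ((λ ()) , All.¬Any⇒All¬ _ (λ e∈q → e∉p (sub e∈q)) ∷ simple⇒unique q s , simple⇒distinct q s)

-- Isomorphisms of plane trees

module _ {m : ℕ} where

  module _ (T : BicoloredPlaneTree (suc m)) where
    open BicoloredPlaneTree T
    private module ≈ = IsDecEquivalence isDecEquivalence

    -- As there is at least one edge, no vertex is isolated: either v is the yellow end of edge
    -- `zero`, or a walk from v to that end begins with an edge at v.
    edge-at : ∀ v → ∃[ e ] v ≈ end (colour v) e
    edge-at v with connected v (end yellow zero)
    ... | stop v≈ = zero , subst (λ c → v ≈ end c zero)
                      (sym (trans (colour-cong v≈) (end-colour yellow zero))) v≈
    ... | step c e v≈ _ = e , subst (λ c → v ≈ end c e)
                            (sym (trans (colour-cong v≈) (end-colour c e))) v≈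

    fold-next-end : ∀ c k {e} → end c (fold e (next c) k) ≈ end c e
    fold-next-end c zero    = ≈.refl
    fold-next-end c (suc k) = ≈.trans (next-end c _) (fold-next-end c k)

  Commutes : (S T : BicoloredPlaneTree (suc m)) → (Fin (suc m) → Fin (suc m)) → Set
  Commutes S T f = ∀ c e → f (S.next c e) ≡ T.next c (f e)
    where
    module S = BicoloredPlaneTree S
    module T = BicoloredPlaneTree T

  module VertexMap (S T : BicoloredPlaneTree (suc m)) (f : Fin (suc m) → Fin (suc m))
                   (f-next : Commutes S T f) where
    module S = BicoloredPlaneTree S
    module T = BicoloredPlaneTree T
    module S≈ = IsDecEquivalence S.isDecEquivalence
    module T≈ = IsDecEquivalence T.isDecEquivalence

    -- Iterating `next c` leads from e to e′, and f carries these iterates to iterates in T, which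
    -- stay at one vertex.
    ends : ∀ c {e e′} → S.end c e S.≈ S.end c e′ → T.end c (f e) T.≈ T.end c (f e′)
    ends c {e} {e′} e≈e′ with k , eq ← S.next-cyclic c e≈e′ = T≈.sym
      (subst (λ x → T.end c x T.≈ T.end c (f e))
        (trans (sym (fold-map f (f-next c) k)) (cong f eq)) (fold-next-end T c k))

    onVertices : S.V → T.V
    onVertices v = T.end (S.colour v) (f (proj₁ (edge-at S v)))

    onVertices-end : ∀ {v} c e → v S.≈ S.end c e → onVertices v T.≈ T.end c (f e)
    onVertices-end {v} c e v≈ with trans (S.colour-cong v≈) (S.end-colour c e)
    ... | refl = ends c (S≈.trans (S≈.sym (proj₂ (edge-at S v))) v≈)

    onVertices-cong : ∀ {v w} → v S.≈ w → onVertices v T.≈ onVertices w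
    onVertices-cong {v} {w} v≈w = onVertices-end _ _ (S≈.trans v≈w (proj₂ (edge-at S w)))

  onVertices-inverse : ∀ S T f g (f-next : Commutes S T f) (g-next : Commutes T S g) →
                       (∀ e → f (g e) ≡ e) → ∀ v →
                       BicoloredPlaneTree._≈_ T
                         (VertexMap.onVertices S T f f-next (VertexMap.onVertices T S g g-next v)) v
  onVertices-inverse S T f g f-next g-next fg v =
    F.T≈.trans (F.onVertices-end _ _ F.S≈.refl)
      (subst (λ e → F.T.end (F.T.colour v) e F.T.≈ v) (sym (fg _)) (F.T≈.sym (proj₂ (edge-at T v))))
    where module F = VertexMap S T f f-next

  Commutes-sym : ∀ {S T} (E : Fin (suc m) ↔ Fin (suc m)) →
                 Commutes S T (Inverse.to E) → Commutes T S (Inverse.from E)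
  Commutes-sym {S} {T} E E-next c e = begin
    E.from (T.next c e)                      ≡⟨ cong (λ x → E.from (T.next c x)) (E.strictlyInverseˡ e) ⟨
    E.from (T.next c (E.to (E.from e)))      ≡⟨ cong E.from (E-next c (E.from e)) ⟨
    E.from (E.to (S.next c (E.from e)))      ≡⟨ E.strictlyInverseʳ _ ⟩
    S.next c (E.from e)                      ∎
    where
    open ≡-Reasoning
    module S = BicoloredPlaneTree S
    module T = BicoloredPlaneTree T
    module E = Inverse E

  -- The vertices carry no further data: each has an edge, and edges share an end of colour c
  -- exactly when iterating `next c` leads from one to the other.
  commutes⇒≅ : ∀ {S T} (E : Fin (suc m) ↔ Fin (suc m)) → Commutes S T (Inverse.to E) → S ≅ T
  commutes⇒≅ {S} {T} E E-next = record
    { onVertices = record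
      { to = F.onVertices
      ; from = G.onVertices
      ; to-cong = F.onVertices-cong
      ; from-cong = G.onVertices-cong
      ; inverse =
          (λ {w} v≈ → F.T≈.trans (F.onVertices-cong v≈)
            (onVertices-inverse S T E.to E.from E-next E⁻¹-next E.strictlyInverseˡ w)) ,
          (λ {v} w≈ → G.T≈.trans (G.onVertices-cong w≈)
            (onVertices-inverse T S E.from E.to E⁻¹-next E-next E.strictlyInverseʳ v))
      }
    ; onEdges = E
    ; colour-preserving = λ v → F.T.end-colour _ _
    ; end-preserving = λ c e → F.onVertices-end c e F.S≈.refl
    ; next-preserving = E-next
    }
    where
    module E = Inverse E
    E⁻¹-next = Commutes-sym {S} {T} E E-next
    module F = VertexMap S T E.to E-next
    module G = VertexMap T S E.from E⁻¹-next

  ≅-isEquivalence : IsEquivalence (_≅_ {suc m})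
  ≅-isEquivalence = record
    { refl = commutes⇒≅ (↔-id _) λ c e → refl
    ; sym = λ {S} {T} S≅T → commutes⇒≅ (↔-sym (_≅_.onEdges S≅T))
              (Commutes-sym {S} {T} (_≅_.onEdges S≅T) (_≅_.next-preserving S≅T))
    ; trans = λ S≅T T≅U → commutes⇒≅ (_≅_.onEdges T≅U ↔-∘ _≅_.onEdges S≅T)
        λ c e → trans (cong (Inverse.to (_≅_.onEdges T≅U)) (_≅_.next-preserving S≅T c e))
                      (_≅_.next-preserving T≅U c _)
    }

-- Rotation classes and isomorphism classes

module _ {m : ℕ} where

  -- A form of `fold π R k ≐ ρ` with forward rotations only, so that exponents simply add.
  RotatedBy : ℕ → Partition (suc m) → Partition (suc m) → Set
  RotatedBy k π ρ = ∀ i j → Partition._∼_ π i j ⇔ Partition._∼_ ρ (rot k i) (rot k j)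

  -- An inverse exponent, since `k + unrot k` is (k + 1) n with n = m + 1. It is visibly nonzero, as
  -- `~ᴿ` demands.
  unrot : ℕ → ℕ
  unrot k = suc (m + k * m)

  rot-+-unrot : ∀ k (i : Fin (suc m)) → rot (k + unrot k) i ≡ i
  rot-+-unrot k i = trans (cong (λ x → rot x i) k+unrot) (rot-*n (suc k) i)
    where
    open ≡-Reasoning
    k+unrot : k + unrot k ≡ suc k * suc m
    k+unrot = begin
      k + (suc m + k * m)   ≡⟨ +-assoc k (suc m) (k * m) ⟨
      k + suc m + k * m     ≡⟨ cong (_+ k * m) (+-comm k (suc m)) ⟩
      suc m + k + k * m     ≡⟨ +-assoc (suc m) k (k * m) ⟩
      suc m + (k + k * m)   ≡⟨ cong (suc m +_) (*-suc k m) ⟨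
      suc m + k * suc m     ∎

  rot-unrot : ∀ k (i : Fin (suc m)) → rot k (rot (unrot k) i) ≡ i
  rot-unrot k i = trans (sym (rot-+ k (unrot k) i)) (rot-+-unrot k i)

  unrot-rot : ∀ k (i : Fin (suc m)) → rot (unrot k) (rot k i) ≡ i
  unrot-rot k i = trans (rot-comm (unrot k) k i) (rot-unrot k i)

  rot-↔ : ℕ → Fin (suc m) ↔ Fin (suc m)
  rot-↔ k = mk↔ₛ′ (rot k) (rot (unrot k)) (rot-unrot k) (unrot-rot k)

  Rᵏ-RotatedBy : ∀ k π → RotatedBy k π (fold π R k)
  Rᵏ-RotatedBy zero    π i j = ⇔-id _
  Rᵏ-RotatedBy (suc k) π i j = mk⇔
    (λ i∼j → subst₂ _∼ₖ_ (sym (rotate⁻¹-rotate _)) (sym (rotate⁻¹-rotate _)) (to i∼j))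
    (λ i∼j → from (subst₂ _∼ₖ_ (rotate⁻¹-rotate _) (rotate⁻¹-rotate _) i∼j))
    where
    open Equivalence (Rᵏ-RotatedBy k π i j)
    _∼ₖ_ = Partition._∼_ (fold π R k)

  ≐⇒RotatedBy : ∀ k π ρ → fold π R k ≐ ρ → RotatedBy k π ρ
  ≐⇒RotatedBy k π ρ eq i j = eq (rot k i) (rot k j) ⇔-∘ Rᵏ-RotatedBy k π i j

  RotatedBy⇒≐ : ∀ k π ρ → RotatedBy k π ρ → fold π R k ≐ ρ
  RotatedBy⇒≐ k π ρ rotated i j =
    subst₂ (λ x y → Partition._∼_ (fold π R k) x y ⇔ Partition._∼_ ρ x y) (rot-unrot k i) (rot-unrot k j)
      (rotated _ _ ⇔-∘ ⇔-sym (Rᵏ-RotatedBy k π _ _))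

  ~ᴿ-isEquivalence : IsEquivalence (_~ᴿ_ {suc m})
  ~ᴿ-isEquivalence = record
    -- Exponent 0 is excluded, so the identity is taken as a full turn.
    { refl = λ {π} → suc m , (λ ()) , RotatedBy⇒≐ (suc m) (partition π) (partition π) λ i j → mk⇔
        (subst₂ (_∼_ π) (sym (rot-n i)) (sym (rot-n j))) (subst₂ (_∼_ π) (rot-n i) (rot-n j))
    ; sym = λ { {π} {ρ} (k , _ , eq) → unrot k , (λ ()) , RotatedBy⇒≐ (unrot k) (partition ρ) (partition π) λ i j →
        subst₂ (λ x y → _∼_ ρ x y ⇔ _∼_ π (rot (unrot k) i) (rot (unrot k) j)) (rot-unrot k i) (rot-unrot k j)
          (⇔-sym (≐⇒RotatedBy k (partition π) (partition ρ) eq _ _)) }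
    ; trans = λ { {π} {ρ} {τ} (k , k≢0 , eq) (l , _ , eq′) →
        l + k , (λ l+k≡0 → k≢0 (m+n≡0⇒n≡0 l l+k≡0)) , RotatedBy⇒≐ (l + k) (partition π) (partition τ) λ i j →
        subst₂ (λ x y → _∼_ π i j ⇔ _∼_ τ x y) (sym (rot-+ l k i)) (sym (rot-+ l k j))
          (≐⇒RotatedBy l (partition ρ) (partition τ) eq′ _ _ ⇔-∘ ≐⇒RotatedBy k (partition π) (partition ρ) eq i j) }
    }
    where open NoncrossingPartition

  tree : NoncrossingPartition (suc m) → BicoloredPlaneTree (suc m)
  tree π = planeTree (𝒯 π) (𝒯-isTree π)

  -- As yellow ∘ white is rotate on each side, commuting with rotate and with
  -- yellow entails commuting with white.
  tree-cong : ∀ {π ρ} → π ~ᴿ ρ → tree π ≅ tree ρ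
  tree-cong {π} {ρ} (k , _ , eq) = commutes⇒≅ (rot-↔ k) λ { yellow → yellow-commutes ; white → white-commutes }
    where
    open ≡-Reasoning
    open NoncrossingPartition using (partition)
    yellow-commutes : ∀ i → rot k (nextSide π yellow i) ≡ nextSide ρ yellow (rot k i)
    yellow-commutes i = First-unique
      (First-map (rot k) (rot-rotate k) (λ j → ≐⇒RotatedBy k (partition π) (partition ρ) eq i j) (next-First π yellow i))
      (next-First ρ yellow (rot k i))
    white-commutes : ∀ i → rot k (nextSide π white i) ≡ nextSide ρ white (rot k i)
    white-commutes i = next-injective ρ yellow (begin
      nextSide ρ yellow (rot k (nextSide π white i))   ≡⟨ yellow-commutes (nextSide π white i) ⟨
      rot k (nextSide π yellow (nextSide π white i))   ≡⟨ cong (rot k) (next-yellow-white π i) ⟩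
      rot k (rotate i)                                 ≡⟨ rot-rotate k i ⟩
      rotate (rot k i)                                 ≡⟨ next-yellow-white ρ (rot k i) ⟨
      nextSide ρ yellow (nextSide ρ white (rot k i))   ∎)

  tree-injective : ∀ {π ρ} → tree π ≅ tree ρ → π ~ᴿ ρ
  tree-injective {π} {ρ} π≅ρ with k , _ , eq ← rot-transitive zero (Inverse.to (_≅_.onEdges π≅ρ) zero) =
    -- The extra full turn makes the exponent nonzero.
    suc m + k , (λ ()) , RotatedBy⇒≐ (suc m + k) partition partition′ λ i j →
      subst₂ (λ x y → (i ∼ j) ⇔ (x ∼′ y)) (E≡rot i) (E≡rot j) (mk⇔
        (λ i∼j → proj₂ (F.ends yellow (refl , i∼j)))
        (λ i∼j → subst₂ _∼_ (E.strictlyInverseʳ i) (E.strictlyInverseʳ j)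
          (proj₂ (F⁻¹.ends yellow (refl , i∼j)))))
    where
    open ≡-Reasoning
    open NoncrossingPartition π
    open NoncrossingPartition ρ using () renaming (_∼_ to _∼′_; partition to partition′)
    module E = Inverse (_≅_.onEdges π≅ρ)
    E-next = _≅_.next-preserving π≅ρ
    module F = VertexMap (tree π) (tree ρ) E.to E-next
    module F⁻¹ = VertexMap (tree ρ) (tree π) E.from (Commutes-sym {S = tree π} {T = tree ρ} (_≅_.onEdges π≅ρ) E-next)

    E-rotate : ∀ i → E.to (rotate i) ≡ rotate (E.to i)
    E-rotate i = begin
      E.to (rotate i)                                  ≡⟨ cong E.to (next-yellow-white π i) ⟨
      E.to (nextSide π yellow (nextSide π white i))    ≡⟨ E-next yellow _ ⟩
      nextSide ρ yellow (E.to (nextSide π white i))    ≡⟨ cong (nextSide ρ yellow) (E-next white i) ⟩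
      nextSide ρ yellow (nextSide ρ white (E.to i))    ≡⟨ next-yellow-white ρ (E.to i) ⟩
      rotate (E.to i)                                  ∎

    E≡rot : ∀ i → E.to i ≡ rot (suc m + k) i
    E≡rot i with l , _ , eq′ ← rot-transitive zero i = begin
      E.to i                        ≡⟨ cong E.to eq′ ⟨
      E.to (rot l zero)             ≡⟨ fold-map E.to E-rotate l ⟩
      rot l (E.to zero)             ≡⟨ cong (rot l) eq ⟨
      rot l (rot k zero)            ≡⟨ rot-comm l k zero ⟩
      rot k (rot l zero)            ≡⟨ cong (rot k) eq′ ⟩
      rot k i                       ≡⟨ rot-n (rot k i) ⟨
      rot (suc m) (rot k i)         ≡⟨ rot-+ (suc m) k i ⟨
      rot (suc m + k) i             ∎

-- Iterates of injective maps

fold-injective : ∀ {A : Set} (s : A → A) → (∀ {x y} → s x ≡ s y → x ≡ y) →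
                 ∀ k {x y} → fold x s k ≡ fold y s k → x ≡ y
fold-injective s s-injective zero    eq = eq
fold-injective s s-injective (suc k) eq = fold-injective s s-injective k (s-injective eq)

fold-∸ : ∀ {A : Set} (s : A → A) → (∀ {x y} → s x ≡ s y → x ≡ y) →
         ∀ {z i j} → i ≤ j → fold z s i ≡ fold z s j → fold z s (j ∸ i) ≡ z
fold-∸ s s-injective {z} {i} {j} i≤j eq = fold-injective s s-injective i (begin
  fold (fold z s (j ∸ i)) s i ≡⟨ fold-+ z s i ⟨
  fold z s (i + (j ∸ i))      ≡⟨ cong (fold z s) (m+[n∸m]≡n i≤j) ⟩
  fold z s j                  ≡⟨ eq ⟨
  fold z s i                  ∎)
  where open ≡-Reasoning

fold-% : ∀ {A : Set} (s : A → A) {z} p .{{_ : NonZero p}} → fold z s p ≡ z →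
         ∀ k → fold z s (k % p) ≡ fold z s k
fold-% s {z} p z-p k = sym (begin
  fold z s k                             ≡⟨ cong (fold z s) (m≡m%n+[m/n]*n k p) ⟩
  fold z s (k % p + k / p * p)           ≡⟨ fold-+ z s (k % p) ⟩
  fold (fold z s (k / p * p)) s (k % p)  ≡⟨ cong (λ x → fold x s (k % p)) (fold-period s p z-p (k / p)) ⟩
  fold z s (k % p)                       ∎)
  where open ≡-Reasoning

-- Two of the iterates 0, ..., n coincide by the pigeonhole principle, and injectivity cancels the
-- smaller exponent.
injective⇒periodic : ∀ {n} (s : Fin n → Fin n) → (∀ {x y} → s x ≡ s y → x ≡ y) →
                     ∀ z → ∃[ p ] (0 < p × p ≤ n × fold z s p ≡ z)
injective⇒periodic {n} s s-injective z
  with i , j , i<j , eq ← Fin.pigeonhole (n<1+n n) (λ k → fold z s (toℕ k))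
  = toℕ j ∸ toℕ i , m<n⇒0<n∸m i<j , ≤-trans (m∸n≤m (toℕ j) (toℕ i)) (Fin.toℕ≤pred[n] j) ,
    fold-∸ s s-injective (<⇒≤ i<j) eq

-- The contour of a plane tree

module Contour {m : ℕ} (T : BicoloredPlaneTree (suc m)) where
  open BicoloredPlaneTree T
  private
    module ≈ = IsDecEquivalence isDecEquivalence

  nextEdge-injective : ∀ c {e f} → next c e ≡ next c f → e ≡ f
  nextEdge-injective c = periodic⇒injective (next c) λ e → let k , eq = next-cyclic c (next-end c e) in
    k , trans (sym (fold-suc (next c) k)) eq

  -- The successor of e among the edges traversed from yellow to white by the
  -- walk around the tree.
  contour : Fin (suc m) → Fin (suc m)
  contour e = next yellow (next white e)

  contour-injective : ∀ {e f} → contour e ≡ contour f → e ≡ f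
  contour-injective eq = nextEdge-injective white (nextEdge-injective yellow eq)

  -- v lies in the component of the yellow end of x when x is deleted.
  YellowSide : Fin (suc m) → V → Set
  YellowSide x v = Σ[ p ∈ Walk graph v (end yellow x) ] x ∉ edges graph p

  YellowSide-resp : ∀ {x v w} → v ≈ w → YellowSide x w → YellowSide x v
  YellowSide-resp v≈w (p , x∉p) = restart ≈.trans v≈w p ,
    subst (_ ∉_) (sym (edges-restart ≈.trans v≈w p)) x∉p

  YellowSide-base : ∀ {x v} → v ≈ end yellow x → YellowSide x v
  YellowSide-base v≈ = stop v≈ , λ ()

  YellowSide-edge : ∀ {x e} c → e ≢ x → YellowSide x (end (opposite c) e) → YellowSide x (end c e)
  YellowSide-edge {e = e} c e≢x (p , x∉p) = step c e ≈.refl p ,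
    λ { (here x≡e) → e≢x (sym x≡e) ; (there x∈p) → x∉p x∈p }

  ¬YellowSide-white : ∀ {x v} → v ≈ end white x → ¬ YellowSide x v
  ¬YellowSide-white v≈ q with p , x∉p ← YellowSide-resp (≈.sym v≈) q = walk-uses-edge isTree p x∉p

  -- The walk around the tree leaves the yellow side of x only through x.
  contour-step : ∀ {x e} → YellowSide x (end yellow e) → e ≢ x →
                 YellowSide x (end yellow (contour e)) × next white e ≢ x
  contour-step {x} {e} q e≢x =
    YellowSide-resp (next-end yellow _) (YellowSide-edge yellow we≢x at-white) , we≢x
    where
    at-white : YellowSide x (end white (next white e))
    at-white = YellowSide-resp (next-end white e) (YellowSide-edge white e≢x q)
    we≢x : next white e ≢ x
    we≢x eq = ¬YellowSide-white (≈.reflexive (cong (end white) eq)) at-white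

  Orbit : Fin (suc m) → Fin (suc m) → Set
  Orbit e f = ∃[ k ] fold e contour k ≡ f

  Orbit-trans : ∀ {e f g} → Orbit e f → Orbit f g → Orbit e g
  Orbit-trans {e} (k , refl) (l , refl) = l + k , fold-+ e contour l

  Orbit-sym : ∀ {e f} → Orbit e f → Orbit f e
  Orbit-sym {e} (k , refl) with suc p , _ , _ , eq ← injective⇒periodic contour contour-injective e =
    -- The period is p + 1, and k * p more steps complete k periods.
    k * p , (begin
      fold (fold e contour k) contour (k * p) ≡⟨ fold-+ e contour (k * p) ⟨
      fold e contour (k * p + k)              ≡⟨ cong (fold e contour) (trans (+-comm (k * p) k) (sym (*-suc k p))) ⟩
      fold e contour (k * suc p)              ≡⟨ fold-period contour (suc p) eq k ⟩
      e                                       ∎)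
    where open ≡-Reasoning

  -- Until it meets x, the contour stays on the yellow side of x. Were x not met before the orbit
  -- closes up, the closing step would enter `next yellow x`, hence come through x by injectivity,
  -- which `contour-step` excludes.
  Orbit-yellow : ∀ x → Orbit (next yellow x) x
  Orbit-yellow x with suc p , _ , _ , period ← injective⇒periodic contour contour-injective (next yellow x)
    with reach p
    where
    reach : ∀ k → Orbit (next yellow x) x ⊎ YellowSide x (end yellow (fold (next yellow x) contour k))
    reach zero = inj₂ (YellowSide-base (next-end yellow x))
    reach (suc k) with reach k
    ... | inj₁ found = inj₁ found
    ... | inj₂ q with fold (next yellow x) contour k Fin.≟ x
    ...   | yes eq = inj₁ (k , eq)
    ...   | no e≢x = inj₂ (proj₁ (contour-step q e≢x))
  ... | inj₁ found = found
  ... | inj₂ q with fold (next yellow x) contour p Fin.≟ x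
  ...   | yes eq = p , eq
  ...   | no e≢x = ⊥-elim (proj₂ (contour-step q e≢x) (nextEdge-injective yellow period))

  Orbit-next : ∀ c e → Orbit e (next c e)
  Orbit-next yellow e = Orbit-sym (Orbit-yellow e)
  Orbit-next white  e = Orbit-trans (1 , refl) (Orbit-yellow (next white e))

  Orbit-end : ∀ c {e f} → end c e ≈ end c f → Orbit e f
  Orbit-end c {e} e≈f with k , refl ← next-cyclic c e≈f = Orbit-fold k
    where
    Orbit-fold : ∀ k → Orbit e (fold e (next c) k)
    Orbit-fold zero    = 0 , refl
    Orbit-fold (suc k) = Orbit-trans (Orbit-fold k) (Orbit-next c _)

  Orbit-vertex : ∀ {c d e f v} → v ≈ end c e → v ≈ end d f → Orbit e f
  Orbit-vertex {c} {d} {e} {f} v≈e v≈f with trans (sym (end-colour c e))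
    (trans (colour-cong (≈.trans (≈.sym v≈e) v≈f)) (end-colour d f))
  ... | refl = Orbit-end c (≈.trans (≈.sym v≈e) v≈f)

  Orbit-walk : ∀ {c d e f v w} → Walk graph v w → v ≈ end c e → w ≈ end d f → Orbit e f
  Orbit-walk (stop v≈w) v≈e w≈f = Orbit-vertex v≈e (≈.trans v≈w w≈f)
  Orbit-walk (step c g v≈g p) v≈e w≈f = Orbit-trans (Orbit-vertex v≈e v≈g) (Orbit-walk p ≈.refl w≈f)

  abstract
    contour-transitive : ∀ e f → Orbit e f
    contour-transitive e f = Orbit-walk (connected (end white e) (end white f)) ≈.refl ≈.refl

  -- The contour reaches every edge from `zero`, and the number of steps reduced modulo the period p
  -- still determines the edge.
  n≤period : ∀ {p} → 0 < p → fold zero contour p ≡ zero → suc m ≤ p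
  n≤period {p@(suc _)} _ period = Fin.injective⇒≤ {f = index} λ {e} {f} eq →
    trans (sym (index-fold e)) (trans (cong (λ k → fold zero contour (toℕ k)) eq) (index-fold f))
    where
    index : Fin (suc m) → Fin p
    index e = proj₁ (contour-transitive zero e) mod p
    index-fold : ∀ e → fold zero contour (toℕ (index e)) ≡ e
    index-fold e with k , eq ← contour-transitive zero e =
      trans (cong (fold zero contour) (toℕ-mod k)) (trans (fold-% contour p period k) eq)

  period-n : fold zero contour (suc m) ≡ zero
  period-n with p , 0<p , p≤n , period ← injective⇒periodic contour contour-injective zero =
    subst (λ k → fold zero contour k ≡ zero) (≤-antisym p≤n (n≤period 0<p period)) period

  abstract
    label : Fin (suc m) → Fin (suc m)
    label i = fold zero contour (toℕ i)

    label-≢ : ∀ {i j} → toℕ i < toℕ j → label i ≢ label j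
    label-≢ {i} {j} i<j eq = <⇒≱ (Fin.toℕ<n j) (≤-trans
      (n≤period (m<n⇒0<n∸m i<j) (fold-∸ contour contour-injective (<⇒≤ i<j) eq)) (m∸n≤m (toℕ j) (toℕ i)))

    label-injective : ∀ {i j} → label i ≡ label j → i ≡ j
    label-injective {i} {j} eq with <-cmp (toℕ i) (toℕ j)
    ... | tri< i<j _ _ = ⊥-elim (label-≢ i<j eq)
    ... | tri≈ _ i≡j _ = Fin.toℕ-injective i≡j
    ... | tri> _ _ j<i = ⊥-elim (label-≢ j<i (sym eq))

    index : Fin (suc m) → Fin (suc m)
    index e = proj₁ (contour-transitive zero e) mod suc m

    label-index : ∀ e → label (index e) ≡ e
    label-index e with k , eq ← contour-transitive zero e =
      trans (cong (fold zero contour) (toℕ-mod k)) (trans (fold-% contour (suc m) period-n k) eq)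

    label-rotate : ∀ i → label (rotate i) ≡ contour (label i)
    label-rotate i with toℕ i ≟ m
    ... | no i≢m = cong (fold zero contour) (rotate-notLast i≢m)
    ... | yes i≡m = begin
      label (rotate i)              ≡⟨ cong label (rotate-last i≡m) ⟩
      zero                          ≡⟨ period-n ⟨
      fold zero contour (suc m)     ≡⟨ cong (λ k → contour (fold zero contour k)) i≡m ⟨
      contour (label i)             ∎
      where open ≡-Reasoning

  label-↔ : Fin (suc m) ↔ Fin (suc m)
  label-↔ = mk↔ₛ′ label index label-index λ i → label-injective (label-index (label i))

  -- The partition obtained by numbering the edges along the contour

  nextInBlock : Fin (suc m) → Fin (suc m)
  nextInBlock i = index (next yellow (label i))

  label-nextInBlock : ∀ i → label (nextInBlock i) ≡ next yellow (label i)
  label-nextInBlock i = label-index _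

  jump : ∀ i → ∃[ d ] (0 < d × d ≤ suc m × rot d i ≡ nextInBlock i)
  jump i with rot-transitive i (nextInBlock i)
  -- A block with one point is met again after a full turn: the distance is n, not 0.
  ... | zero  , _ , eq   = suc m , z<s , ≤-refl , trans (rot-n i) eq
  ... | suc d , d<n , eq = suc d , z<s , <⇒≤ d<n , eq

  -- Named for the points outside the open interval that edge i cuts off, from i to `nextInBlock i`.
  Outside : Fin (suc m) → Fin (suc m) → Set
  Outside i j = YellowSide (label i) (end yellow (label j))

  Outside-step : ∀ {i j} → Outside i j → j ≢ i → Outside i (rotate j) × nextInBlock i ≢ rotate j
  Outside-step {i} {j} q j≢i with q′ , wj≢i ← contour-step q (λ eq → j≢i (label-injective eq)) =
    subst (λ e → YellowSide (label i) (end yellow e)) (sym (label-rotate j)) q′ ,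
    λ eq → wj≢i (nextEdge-injective yellow (begin
      next yellow (next white (label j)) ≡⟨ label-rotate j ⟨
      label (rotate j)                   ≡⟨ cong label eq ⟨
      label (nextInBlock i)              ≡⟨ label-nextInBlock i ⟩
      next yellow (label i)              ∎))
    where open ≡-Reasoning

  -- The points strictly between i and nextInBlock i (mod n) are exactly those
  -- reached through the white end of edge i.
  module _ {i d} (0<d : 0 < d) (d≤n : d ≤ suc m) (rot-d : rot d i ≡ nextInBlock i) where

    -- A point outside is followed by points outside until i is met, none of them `nextInBlock i`.
    -- Starting between i and `nextInBlock i`, however, the rotation arrives there before meeting i.
    before-jump : ∀ {s} → 0 < s → s < d → ¬ Outside i (rot s i)
    before-jump {s} 0<s s<d = advance (d ∸ suc s) 0<s (m+[n∸m]≡n s<d)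
      where
      advance : ∀ g {s} → 0 < s → suc s + g ≡ d → ¬ Outside i (rot s i)
      step-on : ∀ g {s} → suc s + g ≡ d → ¬ (Outside i (rot (suc s) i) × nextInBlock i ≢ rot (suc s) i)
      advance g {s} 0<s eq q = step-on g eq
        (Outside-step q (rot-≢ i 0<s (<-≤-trans (≤-trans (m≤m+n (suc s) g) (≤-reflexive eq)) d≤n)))
      step-on zero {s} eq (_ , miss) =
        miss (trans (sym rot-d) (cong (λ k → rot k i) (trans (sym eq) (+-identityʳ (suc s)))))
      step-on (suc g) {s} eq (q , _) = advance g z<s (trans (sym (+-suc (suc s) g)) eq) q

    -- `nextInBlock i` shares the yellow end of edge i, and from there the rotation stays outside up
    -- to its return to i.
    after-jump : ∀ {s} → d ≤ s → s ≤ suc m → Outside i (rot s i)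
    after-jump {s} d≤s s≤n = subst (λ k → Outside i (rot k i)) (m∸n+n≡m d≤s)
      (advance (s ∸ d) (subst (_≤ suc m) (sym (m∸n+n≡m d≤s)) s≤n))
      where
      advance : ∀ g → g + d ≤ suc m → Outside i (rot (g + d) i)
      advance zero _ = YellowSide-base (≈.trans
        (≈.reflexive (cong (end yellow) (trans (cong label rot-d) (label-nextInBlock i))))
        (next-end yellow (label i)))
      advance (suc g) g+d<n = proj₁ (Outside-step (advance g (<⇒≤ g+d<n))
        (rot-≢ i (<-≤-trans 0<d (m≤n+m d g)) g+d<n))

  partition : Partition (suc m)
  partition = record
    { _∼_ = λ i j → end yellow (label i) ≈ end yellow (label j)
    ; isDecEquivalence = On.isDecEquivalence (λ i → end yellow (label i)) isDecEquivalence
    }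
  open Partition partition using (_∼_)

  Outside-resp : ∀ {i j k} → j ∼ k → Outside i k → Outside i j
  Outside-resp = YellowSide-resp

  nextInBlock-∼ : ∀ i → nextInBlock i ∼ i
  nextInBlock-∼ i = ≈.trans (≈.reflexive (cong (end yellow) (label-nextInBlock i))) (next-end yellow (label i))

  -- Some z in the block of a has b between z and nextInBlock z but not c, hence
  -- not d; then deleting edge z separates b from d.
  noncrossing : Noncrossing partition
  noncrossing {a} {b} {c} {d} a<b b<c c<d (a∼c , b∼d , a≁b) = from-block (<-wellFounded _) ≈.refl a<b
    where
    from-block : ∀ {z} → Acc _<_ (toℕ b ∸ toℕ z) → a ∼ z → toℕ z < toℕ b → ⊥
    from-block {z} (acc rec) a∼z z<b with j , 0<j , j≤n , rot-j ← jump z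
      with j ≤? toℕ b ∸ toℕ z
    -- The jump does not pass b, nor does it land on b, which is in another block; so the argument
    -- continues from a point closer to b.
    ... | yes j≤b-z = from-block (rec (∸-monoʳ-< z<z′ (<⇒≤ z′<b))) a∼z′ z′<b
      where
      z+j≤b : toℕ z + j ≤ toℕ b
      z+j≤b = ≤-trans (+-monoʳ-≤ (toℕ z) j≤b-z) (≤-reflexive (m+[n∸m]≡n (<⇒≤ z<b)))
      toℕ-z′ : toℕ (nextInBlock z) ≡ toℕ z + j
      toℕ-z′ = trans (cong toℕ (sym rot-j)) (toℕ-rot-< j z (≤-<-trans z+j≤b (Fin.toℕ<n b)))
      a∼z′ : a ∼ nextInBlock z
      a∼z′ = ≈.trans a∼z (≈.sym (nextInBlock-∼ z))
      z<z′ : toℕ z < toℕ (nextInBlock z)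
      z<z′ = subst (toℕ z <_) (sym toℕ-z′) (m<m+n (toℕ z) 0<j)
      z′<b : toℕ (nextInBlock z) < toℕ b
      z′<b = ≤∧≢⇒< (subst (_≤ toℕ b) (sym toℕ-z′) z+j≤b)
        λ eq → a≁b (subst (a ∼_) (Fin.toℕ-injective eq) a∼z′)
    ... | no j≰b-z = outside z<b (≰⇒> j≰b-z) (Outside-resp b∼d (beyond z<d j≤d-z))
      where
      z<c = <-trans z<b b<c
      z<d = <-trans z<c c<d
      outside : ∀ {p} → toℕ z < toℕ p → toℕ p ∸ toℕ z < j → ¬ Outside z p
      outside z<p p-z<j q = before-jump 0<j j≤n rot-j (m<n⇒0<n∸m z<p) p-z<j
        (subst (Outside z) (sym (rot-∸ (<⇒≤ z<p))) q)
      beyond : ∀ {p} → toℕ z < toℕ p → j ≤ toℕ p ∸ toℕ z → Outside z p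
      beyond {p} z<p j≤p-z = subst (Outside z) (rot-∸ (<⇒≤ z<p))
        (after-jump 0<j j≤n rot-j j≤p-z (≤-trans (m∸n≤m (toℕ p) (toℕ z)) (Fin.toℕ≤n p)))
      -- As c shares the yellow end of z, it is not jumped over, so the jump ends at c or before.
      j≤d-z : j ≤ toℕ d ∸ toℕ z
      j≤d-z = ≤-trans (≮⇒≥ λ c-z<j → outside z<c c-z<j
          (YellowSide-base (≈.trans (≈.sym a∼c) a∼z)))
        (∸-monoˡ-≤ (toℕ z) (<⇒≤ c<d))

  noncrossingPartition : NoncrossingPartition (suc m)
  noncrossingPartition = record { partition = partition ; noncrossing = noncrossing }

  -- The points jumped over are not on the yellow side of edge i, hence not in its block, so the
  -- yellow successors agree. The white ones follow, as both composites are the contour.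
  tree-noncrossingPartition : tree noncrossingPartition ≅ T
  tree-noncrossingPartition = commutes⇒≅ label-↔ λ { yellow → yellow-commutes ; white → white-commutes }
    where
    open ≡-Reasoning
    π = noncrossingPartition
    nextSide-yellow : ∀ i → nextSide π yellow i ≡ nextInBlock i
    nextSide-yellow i with j , 0<j , j≤n , rot-j ← jump i =
      First-unique (next-First π yellow i) (record
        { offset = j
        ; 0<offset = 0<j
        ; offset≤n = j≤n
        ; reaches = rot-j
        ; holds = ≈.sym (nextInBlock-∼ i)
        ; before = λ 0<s s<j i∼ → before-jump 0<j j≤n rot-j 0<s s<j
            (YellowSide-base (≈.sym i∼))
        })
    yellow-commutes : ∀ i → label (nextSide π yellow i) ≡ next yellow (label i)
    yellow-commutes i = trans (cong label (nextSide-yellow i)) (label-nextInBlock i)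
    white-commutes : ∀ i → label (nextSide π white i) ≡ next white (label i)
    white-commutes i = nextEdge-injective yellow (begin
      next yellow (label (nextSide π white i))     ≡⟨ yellow-commutes _ ⟨
      label (nextSide π yellow (nextSide π white i)) ≡⟨ cong label (next-yellow-white π i) ⟩
      label (rotate i)                             ≡⟨ label-rotate i ⟩
      next yellow (next white (label i))           ∎)

mainTheorem1 : (n : ℕ) .{{_ : NonZero n}} →
    Σ[ isTree ∈ ((π : NoncrossingPartition n) → IsBicoloredPlaneTree (𝒯 π)) ]
    IsBijection (_~ᴿ_ {n}) (_≅_ {n})
    (λ π → planeTree (𝒯 π) (isTree π))
mainTheorem1 (suc m) = 𝒯-isTree , record
  { isInjection = record
    { isCongruent = record
      { cong = tree-cong
      ; isEquivalence₁ = ~ᴿ-isEquivalence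
      ; isEquivalence₂ = ≅-isEquivalence
      }
    ; injective = tree-injective
    }
  -- Surjectivity up to equivalence covers every partition in the rotation class of the one
  -- constructed.
  ; surjective = λ T → Contour.noncrossingPartition T , λ π~ →
      IsEquivalence.trans ≅-isEquivalence (tree-cong π~) (Contour.tree-noncrossingPartition T)
  }
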